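{- Let $G$ be a bipartite graph. Then $G$ is a matching double covered brace if and only if $G$ is (isomorphic to) $K_{3,3}$ or $C_4^4$.
   Context: Graphs are finite, loopless, and may have parallel edges (parallel edges are distinct edges, so perfect matchings differing only by the choice of a parallel edge are different). All graphs considered admit a perfect matching (in particular have at least one edge). A connected graph is matching covered if every edge belongs to at least one perfect matching, and matching double covered if every edge belongs to exactly two perfect matchings. For $X\subseteq V(G)$, $\nabla(X)$ is the set of edges with exactly one end in $X$; it is a cut with shores $X$ and $V(G)\setminus X$, and it is trivial if one of its shores is a single vertex. A cut $C=\nabla(X)$ with $|X|$ odd in a matching covered graph is tight if $|C\cap M|=1$ for every perfect matching $M$. A brace is a bipartite matching covered graph with no nontrivial tight cut. $C_4^4$ is the graph obtained from the $4$-cycle by replacing every edge by two parallel edges. $K_{3,3}$ is the complete bipartite graph. -}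

module Defs where

open import Data.Fin using (Fin; zero; suc; remQuot; _↑ˡ_; _↑ʳ_)
open import Data.Fin.Properties using (all?)
open import Data.Fin.Subset using (Subset; _∈_; _∩_; _∪_; ∁; ∣_∣; ⁅_⁆)
open import Data.Nat using (ℕ; _%_; _≟_)
open import Data.Product using (∃; ∃!; _×_; _,_)
open import Data.Sum using (_⊎_)
open import Data.Vec using (tabulate)
open import Function using (_⇔_; _↔_)
open import Function.Bundles using (Inverse)
open import Relation.Binary.Construct.Closure.ReflexiveTransitive using (Star)
open import Relation.Binary.PropositionalEquality using (_≡_; _≢_)
open import Relation.Nullary using (¬_; does)
open import Relation.Nullary.Decidable using (from-yes)

-- Finite loopless multigraphs.  Edges have their own identity, so distinct
-- edges may have the same ends; every edge has two distinct, unordered ends.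
record Graph : Set where
  field
    #V       : ℕ
    #E       : ℕ
    ends     : Fin #E → Subset #V
    two-ends : ∀ e → ∣ ends e ∣ ≡ 2

module _ (G : Graph) where
  open Graph G

  Adjacent : Fin #V → Fin #V → Set
  Adjacent u v = u ≢ v × ∃ λ e → u ∈ ends e × v ∈ ends e

  Connected : Set
  Connected = ∀ u v → Star Adjacent u v

  -- The edges with exactly one end in X.
  ∇ : Subset #V → Subset #E
  ∇ X = tabulate λ e → does (∣ ends e ∩ X ∣ ≟ 1)

  Bipartite : Set
  Bipartite = ∃ λ (A : Subset #V) → ∀ e → e ∈ ∇ A

  IsPerfectMatching : Subset #E → Set
  IsPerfectMatching M = ∀ v → ∃! _≡_ λ e → e ∈ M × v ∈ ends e

  HasPerfectMatching : Set
  HasPerfectMatching = ∃ IsPerfectMatching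

  PerfectMatchingThrough : Fin #E → Subset #E → Set
  PerfectMatchingThrough e M = IsPerfectMatching M × e ∈ M

  MatchingCovered : Set
  MatchingCovered = Connected × (∀ e → ∃ (PerfectMatchingThrough e))

  MatchingDoubleCovered : Set
  MatchingDoubleCovered = Connected × (∀ e → ∃ λ M₁ → ∃ λ M₂ →
    M₁ ≢ M₂ × PerfectMatchingThrough e M₁ × PerfectMatchingThrough e M₂ ×
    (∀ M → PerfectMatchingThrough e M → M ≡ M₁ ⊎ M ≡ M₂))

  -- Cuts are given by a shore X; the other shore is ∁ X.
  TrivialCut : Subset #V → Set
  TrivialCut X = ∣ X ∣ ≡ 1 ⊎ ∣ ∁ X ∣ ≡ 1

  TightCut : Subset #V → Set
  TightCut X = ∣ X ∣ % 2 ≡ 1 × (∀ M → IsPerfectMatching M → ∣ ∇ X ∩ M ∣ ≡ 1)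

  Brace : Set
  Brace = Bipartite × MatchingCovered ×
          ¬ (∃ λ X → TightCut X × ¬ TrivialCut X)

infix 4 _≅_

record _≅_ (G H : Graph) : Set where
  private
    module G = Graph G
    module H = Graph H
  field
    onV : Fin G.#V ↔ Fin H.#V
    onE : Fin G.#E ↔ Fin H.#E
    preserves-incidence : ∀ v e →
      v ∈ G.ends e ⇔ Inverse.to onV v ∈ H.ends (Inverse.to onE e)

ends-K₃₃ : Fin 9 → Subset 6
ends-K₃₃ e = let i , j = remQuot {3} 3 e in ⁅ i ↑ˡ 3 ⁆ ∪ ⁅ 3 ↑ʳ j ⁆

next : Fin 4 → Fin 4
next zero                   = suc zero
next (suc zero)             = suc (suc zero)
next (suc (suc zero))       = suc (suc (suc zero))
next (suc (suc (suc zero))) = zero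

-- Edge (i , k) is the k-th of the two parallel edges joining i and next i.
ends-C₄⁴ : Fin 8 → Subset 4
ends-C₄⁴ e = let i , _ = remQuot {4} 2 e in ⁅ i ⁆ ∪ ⁅ next i ⁆

K₃₃ : Graph
K₃₃ = record
  { #V = 6 ; #E = 9 ; ends = ends-K₃₃
  ; two-ends = from-yes (all? λ e → ∣ ends-K₃₃ e ∣ ≟ 2) }

C₄⁴ : Graph
C₄⁴ = record
  { #V = 4 ; #E = 8 ; ends = ends-C₄⁴
  ; two-ends = from-yes (all? λ e → ∣ ends-C₄⁴ e ∣ ≟ 2) }

{-# OPTIONS --safe #-}
module Submission where

-- Let A, B be the colour classes of a matching double covered brace G, let e = uv be an edge and
-- M₁, M₂ the two perfect matchings through e.  If an edge f disjoint from e is in no perfect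
-- matching with e, then the vertices reachable from f by M₁-alternating paths avoiding e span,
-- together with one end of e, a shore of a nontrivial tight cut.  So every edge disjoint from
-- e lies in M₁ ∪ M₂, and a vertex w ≠ u of A has at most two edges not ending in v.
--
-- If |A| ≥ 3, a vertex w with at most two neighbours gives a nontrivial tight cut again, so w has
-- a third neighbour, which can only be v; hence G is complete bipartite.  The bound of two
-- edges then forces |A| = 3 and excludes parallel edges.  If |A| = 2, the perfect matchings through e
-- correspond to the edges joining the remaining two vertices, so there are exactly two of these.

open import Defs
import Data.Bool.Properties as Bool
open import Data.Bool using (true; false)
open import Data.Empty using (⊥; ⊥-elim)
open import Data.Fin using (Fin; zero; suc; toℕ; remQuot; combine; splitAt)
open import Data.Fin.Permutation using (Permutation′; id; transpose; _∘ₚ_; _⟨$⟩ʳ_; _⟨$⟩ˡ_; inverseˡ; inverseʳ)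
import Data.Fin.Properties as Fin
open import Data.Fin.Properties using (all?; any?)
open import Data.Fin.Subset using (Subset; _∈_; _∉_; _∩_; _∪_; ∁; ∣_∣; ⁅_⁆; _-_)
open import Data.Fin.Subset.Properties
open import Data.List using (List; []; _∷_; [_])
import Data.List.Membership.Propositional as List
open import Data.List.Relation.Unary.Any using (here; there)
open import Data.Nat using (ℕ; zero; suc; _+_; _*_; _≤_; _<_; z≤n; z<s; s≤s; _%_; _≟_)
open import Data.Nat.DivMod using ([m+kn]%n≡m%n)
import Data.Nat.Properties as ℕ
open import Data.Nat.Solver using (module +-*-Solver)
open import Data.Product using (∃; _×_; _,_; proj₁; proj₂) renaming (swap to ×-swap)
import Data.Product.Properties as ×
open import Data.Sum using (_⊎_; inj₁; inj₂; [_,_]′) renaming (map to ⊎-map; swap to ⊎-swap)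
import Data.Sum.Properties as ⊎
open import Data.Vec using ([]; _∷_; here; there; tabulate)
open import Data.Vec.Functional using (updateAt)
open import Data.Vec.Functional.Properties using (updateAt-updates; updateAt-minimal)
open import Data.Vec.Properties using (lookup∘tabulate; lookup⇒[]=; []=⇒lookup) renaming (≡-dec to Vec-≡-dec)
open import Effect.Monad using (RawMonad)
open import Function using (_∘_; const; case_of_; _↔_)
open import Function.Bundles using (_⇔_; Equivalence; Inverse; mk⇔; mk↔ₛ′)
open import Function.Construct.Composition using (_⇔-∘_)
open import Function.Construct.Symmetry using (⇔-sym)
open import Function.Properties.Inverse using (↔-sym; ↔-trans)
open import Relation.Binary.Construct.Closure.ReflexiveTransitive using (Star; _◅_; fold; gmap)
open import Relation.Binary.PropositionalEquality hiding ([_])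
open import Relation.Nullary using (¬_; Dec; yes; no; does; contradiction)
open import Relation.Nullary.Decidable
  using (dec-true; dec-false; decidable-stable; from-yes; from-no; map′; ¬?; _×-dec_; _⊎-dec_; _→-dec_; ¬¬-excluded-middle)
open import Relation.Nullary.Negation using (¬¬-map; ¬¬-Monad)
open import Relation.Unary using (Decidable)
open +-*-Solver using (solve; _:=_; _:+_; _:*_; con)

-- Finite subsets and counting by injections.

module _ {n} {P : Fin n → Set} (P? : Decidable P) where

  comprehension : Subset n
  comprehension = tabulate (does ∘ P?)

  ∈-comprehension⁺ : ∀ {x} → P x → x ∈ comprehension
  ∈-comprehension⁺ {x} Px =
    lookup⇒[]= x _ (trans (lookup∘tabulate _ x) (dec-true (P? x) Px))

  ∈-comprehension⁻ : ∀ {x} → x ∈ comprehension → P x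
  ∈-comprehension⁻ {x} x∈ with P? x | trans (sym (lookup∘tabulate (does ∘ P?) x)) ([]=⇒lookup x∈)
  ... | yes Px | _ = Px

∣p∣≡1⇒unique : ∀ {n} (p : Subset n) → ∣ p ∣ ≡ 1 →
  ∃ λ x → x ∈ p × (∀ {y} → y ∈ p → y ≡ x)
∣p∣≡1⇒unique (false ∷ p) ∣p∣≡1 with ∣p∣≡1⇒unique p ∣p∣≡1
... | x , x∈p , unique = suc x , there x∈p , λ { (there y∈p) → cong suc (unique y∈p) }
∣p∣≡1⇒unique {suc n} (true ∷ p) ∣p∣≡1 = zero , here , λ
  { here → refl
  ; (there {i = y} y∈p) → contradiction
      (subst (_≤ ∣ p ∣) (∣⁅x⁆∣≡1 y)
        (p⊆q⇒∣p∣≤∣q∣ λ z∈ → subst (_∈ p) (sym (x∈⁅y⁆⇒x≡y y z∈)) y∈p))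
      (ℕ.<⇒≱ (subst (_< 1) (sym (ℕ.suc-injective ∣p∣≡1)) z<s)) }

unique⇒∣p∣≡1 : ∀ {n} {p : Subset n} {x} → x ∈ p → (∀ {y} → y ∈ p → y ≡ x) → ∣ p ∣ ≡ 1
unique⇒∣p∣≡1 {p = p} {x} x∈p unique = trans
  (cong ∣_∣ (⊆-antisym {i = p} {j = ⁅ x ⁆}
    (λ y∈p → subst (_∈ ⁅ x ⁆) (sym (unique y∈p)) (x∈⁅x⁆ x))
    (λ y∈ → subst (_∈ p) (sym (x∈⁅y⁆⇒x≡y x y∈)) x∈p)))
  (∣⁅x⁆∣≡1 x)

∣p∩q∣+∣p∩∁q∣≡∣p∣ : ∀ {n} (p q : Subset n) → ∣ p ∩ q ∣ + ∣ p ∩ ∁ q ∣ ≡ ∣ p ∣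
∣p∩q∣+∣p∩∁q∣≡∣p∣ []          []          = refl
∣p∩q∣+∣p∩∁q∣≡∣p∣ (false ∷ p) (_     ∷ q) = ∣p∩q∣+∣p∩∁q∣≡∣p∣ p q
∣p∩q∣+∣p∩∁q∣≡∣p∣ (true  ∷ p) (true  ∷ q) = cong suc (∣p∩q∣+∣p∩∁q∣≡∣p∣ p q)
∣p∩q∣+∣p∩∁q∣≡∣p∣ (true  ∷ p) (false ∷ q) =
  trans (ℕ.+-suc ∣ p ∩ q ∣ ∣ p ∩ ∁ q ∣) (cong suc (∣p∩q∣+∣p∩∁q∣≡∣p∣ p q))

injection⇒∣p∣≤∣q∣ : ∀ {n m} (p : Subset n) (q : Subset m) (f : Fin n → Fin m) →
  (∀ {x} → x ∈ p → f x ∈ q) →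
  (∀ {x y} → x ∈ p → y ∈ p → f x ≡ f y → x ≡ y) → ∣ p ∣ ≤ ∣ q ∣
injection⇒∣p∣≤∣q∣ []          q f maps inj = z≤n
injection⇒∣p∣≤∣q∣ (false ∷ p) q f maps inj =
  injection⇒∣p∣≤∣q∣ p q (f ∘ suc) (maps ∘ there)
    (λ x∈p y∈p → Fin.suc-injective ∘ inj (there x∈p) (there y∈p))
injection⇒∣p∣≤∣q∣ (true ∷ p) q f maps inj =
  -- `f zero` is withdrawn from `q` before the induction, and its absence makes the resulting bound
  -- strict.
  ℕ.≤-<-trans
    (injection⇒∣p∣≤∣q∣ p (q - f zero) (f ∘ suc)
      (λ x∈p → x∈p∧x≢y⇒x∈p-y (maps (there x∈p))
        λ eq → case inj (there x∈p) here eq of λ ())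
      (λ x∈p y∈p → Fin.suc-injective ∘ inj (there x∈p) (there y∈p)))
    (x∈p⇒∣p-x∣<∣p∣ (maps here))

bijection⇒∣p∣≡∣q∣ : ∀ {n m} (p : Subset n) (q : Subset m) (f : Fin n → Fin m) (g : Fin m → Fin n) →
  (∀ {x} → x ∈ p → f x ∈ q × g (f x) ≡ x) →
  (∀ {y} → y ∈ q → g y ∈ p × f (g y) ≡ y) → ∣ p ∣ ≡ ∣ q ∣
bijection⇒∣p∣≡∣q∣ p q f g pq qp = ℕ.≤-antisym
  (injection⇒∣p∣≤∣q∣ p q f (proj₁ ∘ pq) λ x∈ y∈ eq →
    trans (sym (proj₂ (pq x∈))) (trans (cong g eq) (proj₂ (pq y∈))))
  (injection⇒∣p∣≤∣q∣ q p g (proj₁ ∘ qp) λ x∈ y∈ eq →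
    trans (sym (proj₂ (qp x∈))) (trans (cong f eq) (proj₂ (qp y∈))))

-- Perfect matchings and cuts in a bipartite graph.

NoNontrivialTightCut : Graph → Set
NoNontrivialTightCut G = ¬ (∃ λ X → TightCut G X × ¬ TrivialCut G X)

module _ (G : Graph) where
  open Graph G

  mate : ∀ {M} → IsPerfectMatching G M → Fin #V → Fin #E
  mate pm v = proj₁ (pm v)

  mate∈M : ∀ {M} (pm : IsPerfectMatching G M) v → mate pm v ∈ M
  mate∈M pm v = proj₁ (proj₁ (proj₂ (pm v)))

  ∈-ends-mate : ∀ {M} (pm : IsPerfectMatching G M) v → v ∈ ends (mate pm v)
  ∈-ends-mate pm v = proj₂ (proj₁ (proj₂ (pm v)))

  mate-unique : ∀ {M} (pm : IsPerfectMatching G M) {v e} → e ∈ M → v ∈ ends e → mate pm v ≡ e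
  mate-unique pm {v} e∈M v∈e = proj₂ (proj₂ (pm v)) (e∈M , v∈e)

  ∈∇⁺ : ∀ {X e} → ∣ ends e ∩ X ∣ ≡ 1 → e ∈ ∇ G X
  ∈∇⁺ {X} = ∈-comprehension⁺ (λ e → ∣ ends e ∩ X ∣ ≟ 1)

  ∈∇⁻ : ∀ {X e} → e ∈ ∇ G X → ∣ ends e ∩ X ∣ ≡ 1
  ∈∇⁻ {X} = ∈-comprehension⁻ (λ e → ∣ ends e ∩ X ∣ ≟ 1)

module Bipartition (G : Graph) (A : Subset (Graph.#V G)) (spanning : ∀ e → e ∈ ∇ G A) where
  open Graph G

  V E : Set
  V = Fin #V
  E = Fin #E

  private abstract
    src-spec : ∀ e → ∃ λ v → v ∈ ends e ∩ A × (∀ {u} → u ∈ ends e ∩ A → u ≡ v)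
    src-spec e = ∣p∣≡1⇒unique _ (∈∇⁻ G (spanning e))

    tgt-spec : ∀ e → ∃ λ v → v ∈ ends e ∩ ∁ A × (∀ {u} → u ∈ ends e ∩ ∁ A → u ≡ v)
    tgt-spec e = ∣p∣≡1⇒unique _ (ℕ.+-cancelˡ-≡ 1 _ _
      (trans (cong (_+ ∣ ends e ∩ ∁ A ∣) (sym (∈∇⁻ G (spanning e))))
        (trans (∣p∩q∣+∣p∩∁q∣≡∣p∣ (ends e) A) (two-ends e))))

  -- Every edge is read as directed out of the colour class `A`. All later arguments name vertices
  -- outside `A` only as targets.
  src tgt : E → V
  src e = proj₁ (src-spec e)
  tgt e = proj₁ (tgt-spec e)

  src∈ends : ∀ e → src e ∈ ends e
  src∈ends e = proj₁ (x∈p∩q⁻ (ends e) A (proj₁ (proj₂ (src-spec e))))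

  src∈A : ∀ e → src e ∈ A
  src∈A e = proj₂ (x∈p∩q⁻ (ends e) A (proj₁ (proj₂ (src-spec e))))

  tgt∈ends : ∀ e → tgt e ∈ ends e
  tgt∈ends e = proj₁ (x∈p∩q⁻ (ends e) (∁ A) (proj₁ (proj₂ (tgt-spec e))))

  tgt∉A : ∀ e → tgt e ∉ A
  tgt∉A e = x∈∁p⇒x∉p (proj₂ (x∈p∩q⁻ (ends e) (∁ A) (proj₁ (proj₂ (tgt-spec e)))))

  ∈A⇒≡src : ∀ {v e} → v ∈ ends e → v ∈ A → v ≡ src e
  ∈A⇒≡src {e = e} v∈e v∈A = proj₂ (proj₂ (src-spec e)) (x∈p∩q⁺ (v∈e , v∈A))

  ∉A⇒≡tgt : ∀ {v e} → v ∈ ends e → v ∉ A → v ≡ tgt e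
  ∉A⇒≡tgt {e = e} v∈e v∉A = proj₂ (proj₂ (tgt-spec e)) (x∈p∩q⁺ (v∈e , x∉p⇒x∈∁p v∉A))

  src≢tgt : ∀ {e f} → src e ≢ tgt f
  src≢tgt {e} {f} eq = tgt∉A f (subst (_∈ A) eq (src∈A e))

  ends⁻ : ∀ {v e} → v ∈ ends e → v ≡ src e ⊎ v ≡ tgt e
  ends⁻ {v} v∈e with v ∈? A
  ... | yes v∈A = inj₁ (∈A⇒≡src v∈e v∈A)
  ... | no  v∉A = inj₂ (∉A⇒≡tgt v∈e v∉A)

  module _ {X : Subset #V} {e : E} where

    tgt-only⇒∈∇ : src e ∉ X → tgt e ∈ X → e ∈ ∇ G X
    tgt-only⇒∈∇ s∉X t∈X = ∈∇⁺ G (unique⇒∣p∣≡1 (x∈p∩q⁺ (tgt∈ends e , t∈X)) λ v∈ →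
      let v∈e , v∈X = x∈p∩q⁻ (ends e) X v∈ in
      [ (λ { refl → contradiction v∈X s∉X }) , (λ eq → eq) ]′ (ends⁻ v∈e))

    both⇒∉∇ : src e ∈ X → tgt e ∈ X → e ∉ ∇ G X
    both⇒∉∇ s∈X t∈X e∈∇ with ∣p∣≡1⇒unique _ (∈∇⁻ G e∈∇)
    ... | _ , _ , unique = src≢tgt (trans
      (unique (x∈p∩q⁺ (src∈ends e , s∈X))) (sym (unique (x∈p∩q⁺ (tgt∈ends e , t∈X)))))

    neither⇒∉∇ : src e ∉ X → tgt e ∉ X → e ∉ ∇ G X
    neither⇒∉∇ s∉X t∉X e∈∇ with ∣p∣≡1⇒unique _ (∈∇⁻ G e∈∇)
    ... | v , v∈ , _ = let v∈e , v∈X = x∈p∩q⁻ (ends e) X v∈ in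
      [ (λ { refl → s∉X v∈X }) , (λ { refl → t∉X v∈X }) ]′ (ends⁻ v∈e)

  module Mates {M : Subset #E} (pm : IsPerfectMatching G M) where

    μ : V → E
    μ = mate G pm

    src-μ : ∀ {v} → v ∈ A → src (μ v) ≡ v
    src-μ {v} v∈A = sym (∈A⇒≡src (∈-ends-mate G pm v) v∈A)

    tgt-μ : ∀ {v} → v ∉ A → tgt (μ v) ≡ v
    tgt-μ {v} v∉A = sym (∉A⇒≡tgt (∈-ends-mate G pm v) v∉A)

    μ-src : ∀ {e} → e ∈ M → μ (src e) ≡ e
    μ-src {e} e∈M = mate-unique G pm e∈M (src∈ends e)

    μ-tgt : ∀ {e} → e ∈ M → μ (tgt e) ≡ e
    μ-tgt {e} e∈M = mate-unique G pm e∈M (tgt∈ends e)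

    src-injective : ∀ {e f} → e ∈ M → f ∈ M → src e ≡ src f → e ≡ f
    src-injective e∈M f∈M eq = trans (sym (μ-src e∈M)) (trans (cong μ eq) (μ-src f∈M))

    tgt-injective : ∀ {e f} → e ∈ M → f ∈ M → tgt e ≡ tgt f → e ≡ f
    tgt-injective e∈M f∈M eq = trans (sym (μ-tgt e∈M)) (trans (cong μ eq) (μ-tgt f∈M))

    tgt-μ-injective : ∀ {a b} → a ∈ A → b ∈ A → tgt (μ a) ≡ tgt (μ b) → a ≡ b
    tgt-μ-injective a∈A b∈A eq = trans (sym (src-μ a∈A))
      (trans (cong src (tgt-injective (mate∈M G pm _) (mate∈M G pm _) eq)) (src-μ b∈A))

  record ParallelClass (m : ℕ) (a b : V) : Set where
    field
      edge      : Fin m → E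
      src≡      : ∀ l → src (edge l) ≡ a
      tgt≡      : ∀ l → tgt (edge l) ≡ b
      injective : ∀ {l l′} → edge l ≡ edge l′ → l ≡ l′
      complete  : ∀ {g} → src g ≡ a → tgt g ≡ b → ∃ λ l → edge l ≡ g

  -- Tight cuts from sets closed under taking targets.

  open Mates

  -- Under this condition an edge of the cut has its source outside `X` and its target inside.
  SrcClosed : Subset #V → Set
  SrcClosed X = ∀ {e} → src e ∈ X → tgt e ∈ X

  -- The `M`-edges with target in `X` are counted by their targets. Those with source in `X`
  -- correspond to the vertices of `X ∩ A`, and the others are exactly the cut edges of `M`. The
  -- point is that the excess of `X ∩ ∁ A` over `X ∩ A` does not depend on `M`.
  ∣∇∩M∣-srcClosed : ∀ {X M} → SrcClosed X → IsPerfectMatching G M →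
    ∣ X ∩ ∁ A ∣ ≡ ∣ X ∩ A ∣ + ∣ ∇ G X ∩ M ∣
  ∣∇∩M∣-srcClosed {X} {M} closed pm = begin
    ∣ X ∩ ∁ A ∣                              ≡⟨ bijection⇒∣p∣≡∣q∣ _ _ (μ pm) tgt X∩∁A→ ←X∩∁A ⟩
    ∣ Mᵗ ∣                                   ≡⟨ ∣p∩q∣+∣p∩∁q∣≡∣p∣ Mᵗ Sˢ ⟨
    ∣ Mᵗ ∩ Sˢ ∣ + ∣ Mᵗ ∩ ∁ Sˢ ∣              ≡⟨ cong₂ _+_ (bijection⇒∣p∣≡∣q∣ _ _ src (μ pm) X∩A← →X∩A)
                                                  (cong ∣_∣ (⊆-antisym Mᵗ∖Sˢ⊆ ⊆Mᵗ∖Sˢ)) ⟩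
    ∣ X ∩ A ∣ + ∣ ∇ G X ∩ M ∣                ∎
    where
    open ≡-Reasoning

    s? : Decidable (λ e → src e ∈ X)
    s? e = src e ∈? X

    t? : Decidable (λ e → tgt e ∈ X)
    t? e = tgt e ∈? X

    Sˢ Sᵗ Mᵗ : Subset #E
    Sˢ = comprehension s?
    Sᵗ = comprehension t?
    Mᵗ = M ∩ Sᵗ

    ∈Mᵗ⁻ : ∀ {e} → e ∈ Mᵗ → e ∈ M × tgt e ∈ X
    ∈Mᵗ⁻ e∈ = let e∈M , e∈Sᵗ = x∈p∩q⁻ M Sᵗ e∈ in e∈M , ∈-comprehension⁻ t? e∈Sᵗ

    ∈Mᵗ⁺ : ∀ {e} → e ∈ M → tgt e ∈ X → e ∈ Mᵗ
    ∈Mᵗ⁺ e∈M t∈X = x∈p∩q⁺ (e∈M , ∈-comprehension⁺ t? t∈X)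

    X∩∁A→ : ∀ {v} → v ∈ X ∩ ∁ A → μ pm v ∈ Mᵗ × tgt (μ pm v) ≡ v
    X∩∁A→ {v} v∈ =
      let v∈X , v∈∁A = x∈p∩q⁻ X (∁ A) v∈
          eq = tgt-μ pm (x∈∁p⇒x∉p v∈∁A)
      in ∈Mᵗ⁺ (mate∈M G pm v) (subst (_∈ X) (sym eq) v∈X) , eq

    ←X∩∁A : ∀ {e} → e ∈ Mᵗ → tgt e ∈ X ∩ ∁ A × μ pm (tgt e) ≡ e
    ←X∩∁A {e} e∈ = let e∈M , t∈X = ∈Mᵗ⁻ e∈ in
      x∈p∩q⁺ (t∈X , x∉p⇒x∈∁p (tgt∉A e)) , μ-tgt pm e∈M

    X∩A← : ∀ {e} → e ∈ Mᵗ ∩ Sˢ → src e ∈ X ∩ A × μ pm (src e) ≡ e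
    X∩A← {e} e∈ = let e∈Mᵗ , e∈Sˢ = x∈p∩q⁻ Mᵗ Sˢ e∈ in
      x∈p∩q⁺ (∈-comprehension⁻ s? e∈Sˢ , src∈A e) , μ-src pm (proj₁ (∈Mᵗ⁻ e∈Mᵗ))

    →X∩A : ∀ {v} → v ∈ X ∩ A → μ pm v ∈ Mᵗ ∩ Sˢ × src (μ pm v) ≡ v
    →X∩A {v} v∈ =
      let v∈X , v∈A = x∈p∩q⁻ X A v∈
          eq = src-μ pm v∈A
          s∈X = subst (_∈ X) (sym eq) v∈X
      in x∈p∩q⁺ (∈Mᵗ⁺ (mate∈M G pm v) (closed s∈X) , ∈-comprehension⁺ s? s∈X) , eq

    Mᵗ∖Sˢ⊆ : ∀ {e} → e ∈ Mᵗ ∩ ∁ Sˢ → e ∈ ∇ G X ∩ M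
    Mᵗ∖Sˢ⊆ e∈ =
      let e∈Mᵗ , e∈∁Sˢ = x∈p∩q⁻ Mᵗ (∁ Sˢ) e∈
          e∈M , t∈X = ∈Mᵗ⁻ e∈Mᵗ
      in x∈p∩q⁺ (tgt-only⇒∈∇ (x∈∁p⇒x∉p e∈∁Sˢ ∘ ∈-comprehension⁺ s?) t∈X , e∈M)

    ⊆Mᵗ∖Sˢ : ∀ {e} → e ∈ ∇ G X ∩ M → e ∈ Mᵗ ∩ ∁ Sˢ
    ⊆Mᵗ∖Sˢ {e} e∈ with x∈p∩q⁻ (∇ G X) M e∈ | src e ∈? X | tgt e ∈? X
    ... | e∈∇ , _   | yes s∈X | _       = contradiction e∈∇ (both⇒∉∇ s∈X (closed s∈X))
    ... | e∈∇ , _   | no s∉X  | no t∉X  = contradiction e∈∇ (neither⇒∉∇ s∉X t∉X)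
    ... | _   , e∈M | no s∉X  | yes t∈X =
      x∈p∩q⁺ (∈Mᵗ⁺ e∈M t∈X , x∉p⇒x∈∁p (s∉X ∘ ∈-comprehension⁻ s?))

  -- All perfect matchings cross the cut equally often, so it suffices that a single `M` crosses it
  -- only in `e`.
  srcClosed⇒tight : ∀ {X M e} → SrcClosed X → IsPerfectMatching G M → e ∈ M →
    src e ∉ X → tgt e ∈ X → (∀ {f} → f ∈ M → tgt f ∈ X → src f ∈ X ⊎ f ≡ e) → TightCut G X
  srcClosed⇒tight {X} {M} {e} closed pm e∈M s∉X t∈X onlyCut = odd , tight
    where
    open ≡-Reasoning

    one : ∣ ∇ G X ∩ M ∣ ≡ 1
    one = unique⇒∣p∣≡1 (x∈p∩q⁺ (tgt-only⇒∈∇ s∉X t∈X , e∈M)) only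
      where
      only : ∀ {f} → f ∈ ∇ G X ∩ M → f ≡ e
      only {f} f∈ with x∈p∩q⁻ (∇ G X) M f∈ | src f ∈? X | tgt f ∈? X
      ... | f∈∇ , _   | yes s∈X | _       = contradiction f∈∇ (both⇒∉∇ s∈X (closed s∈X))
      ... | f∈∇ , _   | no s∉X  | no t∉X  = contradiction f∈∇ (neither⇒∉∇ s∉X t∉X)
      ... | _   , f∈M | no s∉X  | yes t∈X =
        [ (λ s∈X → contradiction s∈X s∉X) , (λ eq → eq) ]′ (onlyCut f∈M t∈X)

    tight : ∀ M′ → IsPerfectMatching G M′ → ∣ ∇ G X ∩ M′ ∣ ≡ 1
    tight M′ pm′ = trans
      (ℕ.+-cancelˡ-≡ ∣ X ∩ A ∣ _ _
        (trans (sym (∣∇∩M∣-srcClosed closed pm′)) (∣∇∩M∣-srcClosed closed pm)))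
      one

    k : ℕ
    k = ∣ X ∩ A ∣

    -- `X` has one more vertex outside `A` than inside, which gives the odd size `k + (k + 1)`.
    odd : ∣ X ∣ % 2 ≡ 1
    odd = begin
      ∣ X ∣ % 2                    ≡⟨ cong (_% 2) (∣p∩q∣+∣p∩∁q∣≡∣p∣ X A) ⟨
      (k + ∣ X ∩ ∁ A ∣) % 2        ≡⟨ cong (λ l → (k + l) % 2) (trans (∣∇∩M∣-srcClosed closed pm) (cong (k +_) one)) ⟩
      (k + (k + 1)) % 2            ≡⟨ cong (_% 2) (solve 1 (λ k → k :+ (k :+ con 1) := con 1 :+ k :* con 2) refl k) ⟩
      (1 + k * 2) % 2              ≡⟨ [m+kn]%n≡m%n 1 k 2 ⟩
      1                            ∎

  -- S together with the vertices matched into S ∪ {src e} is the shore of a tight cut.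
  noBlockingSet : NoNontrivialTightCut G → ∀ {M e} (pm : IsPerfectMatching G M) → e ∈ M →
    ∀ {S : V → Set} → Decidable S → ¬ S (src e) →
    (∃ λ j → j ∈ A × S j) → (∃ λ i → i ∈ A × i ≢ src e × ¬ S i) →
    ¬ (∀ g → S (src g) → tgt g ≡ tgt e ⊎ S (src (μ pm (tgt g))))
  noBlockingSet noCut {M} {e} pm e∈M {S} S? e∉S (j , j∈A , Sj) (i , i∈A , i≢e , i∉S) closed =
    noCut (X , srcClosed⇒tight X-closed pm e∈M s∉X t∈X onlyCut , [ ∣X∣≢1 , ∣∁X∣≢1 ]′)
    where
    InX : V → Set
    InX v = v ∈ A × S v ⊎ v ∉ A × (v ≡ tgt e ⊎ S (src (μ pm v)))

    InX? : Decidable InX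
    InX? v = (v ∈? A) ×-dec S? v ⊎-dec ¬? (v ∈? A) ×-dec (v Fin.≟ tgt e ⊎-dec S? (src (μ pm v)))

    X : Subset #V
    X = comprehension InX?

    ∈X⇒S : ∀ {v} → v ∈ A → v ∈ X → S v
    ∈X⇒S v∈A v∈X with ∈-comprehension⁻ InX? v∈X
    ... | inj₁ (_ , Sv)  = Sv
    ... | inj₂ (v∉A , _) = contradiction v∈A v∉A

    X-closed : SrcClosed X
    X-closed {g} s∈X = ∈-comprehension⁺ InX? (inj₂ (tgt∉A g , closed g (∈X⇒S (src∈A g) s∈X)))

    s∉X : src e ∉ X
    s∉X = e∉S ∘ ∈X⇒S (src∈A e)

    t∈X : tgt e ∈ X
    t∈X = ∈-comprehension⁺ InX? (inj₂ (tgt∉A e , inj₁ refl))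

    onlyCut : ∀ {f} → f ∈ M → tgt f ∈ X → src f ∈ X ⊎ f ≡ e
    onlyCut {f} f∈M tf∈X with ∈-comprehension⁻ InX? tf∈X
    ... | inj₁ (tf∈A , _)       = contradiction tf∈A (tgt∉A f)
    ... | inj₂ (_ , inj₁ tf≡te) = inj₂ (tgt-injective pm f∈M e∈M tf≡te)
    ... | inj₂ (_ , inj₂ Sμ)    = inj₁ (∈-comprehension⁺ InX?
      (inj₁ (src∈A f , subst (S ∘ src) (μ-tgt pm f∈M) Sμ)))

    -- Both `j`, in `A`, and `tgt e`, outside `A`, belong to `X`.
    ∣X∣≢1 : ∣ X ∣ ≢ 1
    ∣X∣≢1 ∣X∣≡1 with ∣p∣≡1⇒unique _ ∣X∣≡1
    ... | _ , _ , unique = tgt∉A e (subst (_∈ A)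
      (trans (unique (∈-comprehension⁺ InX? (inj₁ (j∈A , Sj)))) (sym (unique t∈X))) j∈A)

    -- Both `i` and `src e` lie outside `X`, and they differ.
    ∣∁X∣≢1 : ∣ ∁ X ∣ ≢ 1
    ∣∁X∣≢1 ∣∁X∣≡1 with ∣p∣≡1⇒unique _ ∣∁X∣≡1
    ... | _ , _ , unique = i≢e
      (trans (unique (x∉p⇒x∈∁p (i∉S ∘ ∈X⇒S i∈A))) (sym (unique (x∉p⇒x∈∁p s∉X))))

-- Alternating paths and the exchange of matching edges.

transpose-matchˡ : ∀ {n} (i j : Fin n) → transpose i j ⟨$⟩ʳ i ≡ j
transpose-matchˡ i j rewrite dec-true (i Fin.≟ i) refl = refl

transpose-matchʳ : ∀ {n} (i j : Fin n) → transpose i j ⟨$⟩ʳ j ≡ i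
transpose-matchʳ i j with j Fin.≟ i
... | yes j≡i = j≡i
... | no  _ rewrite dec-true (j Fin.≟ j) refl = refl

transpose-mismatch : ∀ {n} {i j k : Fin n} → k ≢ i → k ≢ j → transpose i j ⟨$⟩ʳ k ≡ k
transpose-mismatch {i = i} {j} {k} k≢i k≢j
  rewrite dec-false (k Fin.≟ i) k≢i | dec-false (k Fin.≟ j) k≢j = refl

⟨$⟩ʳ-injective : ∀ {n} (τ : Permutation′ n) {i j} → τ ⟨$⟩ʳ i ≡ τ ⟨$⟩ʳ j → i ≡ j
⟨$⟩ʳ-injective τ eq = trans (sym (inverseˡ τ)) (trans (cong (τ ⟨$⟩ˡ_) eq) (inverseˡ τ))

module Exchange (G : Graph) (A : Subset (Graph.#V G)) (spanning : ∀ e → e ∈ ∇ G A)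
  {M : Subset (Graph.#E G)} (pm : IsPerfectMatching G M) where
  open Graph G
  open Bipartition G A spanning
  open Mates pm

  -- The next vertex of `A` on an alternating walk: go along `g`, then back along the `M`-edge at
  -- its target.
  succ : E → V
  succ g = src (μ (tgt g))

  -- M-alternating paths, recorded by their vertices in A; these are pairwise distinct and
  -- lie outside Z.
  data Path (Z : List V) : V → V → Set where
    []   : ∀ {x} → Path Z x x
    step : ∀ {y} g → succ g List.∉ src g ∷ Z → Path (src g ∷ Z) (succ g) y → Path Z (src g) y

  end∉Z : ∀ {Z x y} → x List.∉ Z → Path Z x y → y List.∉ Z
  end∉Z x∉Z []           = x∉Z
  end∉Z x∉Z (step g s p) = end∉Z s p ∘ there

  -- If the new vertex already occurs on the path, the path is cut off at that occurrence; this
  -- keeps its vertices distinct.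
  extend : ∀ {Z x y} → Path Z x y → ∀ {g} → src g ≡ y → succ g List.∉ Z → Path Z x (succ g)
  extend {x = x} p {g} eq s∉Z with succ g Fin.≟ x
  ... | yes refl = []
  extend []            {g} refl s∉Z | no s≢x = step g (λ { (here eq) → s≢x eq ; (there i) → s∉Z i }) []
  extend (step h h∉ p) {g} eq   s∉Z | no s≢x =
    step h h∉ (extend p eq λ { (here eq) → s≢x eq ; (there i) → s∉Z i })

  -- The result of switching M along a path from x to y: a is now joined by ε a to the
  -- M-partner of τ a, except that y has lost its edge and the M-partner of x is free.
  record Switch (Z : List V) (x y : V) : Set where
    field
      τ     : Permutation′ #V
      ε     : V → E
      τ-end : τ ⟨$⟩ʳ y ≡ x
      src-ε : ∀ {a} → a ∈ A → src (ε a) ≡ a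
      tgt-ε : ∀ {a} → a ∈ A → a ≢ y → tgt (ε a) ≡ tgt (μ (τ ⟨$⟩ʳ a))
      τ-fix : ∀ {a} → a ∉ A ⊎ a List.∈ Z → τ ⟨$⟩ʳ a ≡ a
      ε-fix : ∀ {a} → a List.∈ Z → ε a ≡ μ a

  -- Induction on the path. The switch along the rest fixes `x` and sends `y` to `z`; composing with
  -- the transposition of `x` and `z` sends `x` to `z` and `y` to `x`, while `g` becomes the new
  -- edge at `x`.
  switch : ∀ {Z x y} → x List.∉ Z → Path Z x y → Switch Z x y
  switch _ [] = record
    { τ     = id
    ; ε     = μ
    ; τ-end = refl
    ; src-ε = src-μ
    ; tgt-ε = λ _ _ → refl
    ; τ-fix = λ _ → refl
    ; ε-fix = λ _ → refl
    }
  switch {Z} {x} {y} x∉Z (step g s∉ p) = record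
    { τ     = τ ∘ₚ transpose x z
    ; ε     = ε⁺
    ; τ-end = trans (cong (transpose x z ⟨$⟩ʳ_) τ-end) (transpose-matchʳ x z)
    ; src-ε = src-ε⁺
    ; tgt-ε = tgt-ε⁺
    ; τ-fix = λ {a} a∈ → trans
        (cong (transpose x z ⟨$⟩ʳ_) (τ-fix ([ inj₁ , inj₂ ∘ there ]′ a∈)))
        (transpose-mismatch
          (λ { refl → [ (λ a∉A → a∉A (src∈A g)) , x∉Z ]′ a∈ })
          (λ { refl → [ (λ a∉A → a∉A (src∈A (μ (tgt g)))) , s∉ ∘ there ]′ a∈ }))
    ; ε-fix = λ {a} a∈Z → trans
        (updateAt-minimal a x ε λ { refl → x∉Z a∈Z }) (ε-fix (there a∈Z))
    }
    where
    open Switch (switch s∉ p)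

    z : V
    z = succ g

    ε⁺ : V → E
    ε⁺ = updateAt ε x (const g)

    src-ε⁺ : ∀ {a} → a ∈ A → src (ε⁺ a) ≡ a
    src-ε⁺ {a} a∈A with a Fin.≟ x
    ... | yes refl = cong src (updateAt-updates x ε)
    ... | no  a≢x  = trans (cong src (updateAt-minimal a x ε a≢x)) (src-ε a∈A)

    tgt-ε⁺ : ∀ {a} → a ∈ A → a ≢ y → tgt (ε⁺ a) ≡ tgt (μ (transpose x z ⟨$⟩ʳ (τ ⟨$⟩ʳ a)))
    tgt-ε⁺ {a} a∈A a≢y with a Fin.≟ x
    ... | yes refl = begin
      tgt (ε⁺ x)                                        ≡⟨ cong tgt (updateAt-updates x ε) ⟩
      tgt g                                             ≡⟨ tgt-μ (tgt∉A g) ⟨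
      tgt (μ (tgt g))                                   ≡⟨ cong tgt (μ-src (mate∈M G pm (tgt g))) ⟨
      tgt (μ z)                                         ≡⟨ cong (tgt ∘ μ) (transpose-matchˡ x z) ⟨
      tgt (μ (transpose x z ⟨$⟩ʳ x))                    ≡⟨ cong (λ v → tgt (μ (transpose x z ⟨$⟩ʳ v))) (τ-fix (inj₂ (here refl))) ⟨
      tgt (μ (transpose x z ⟨$⟩ʳ (τ ⟨$⟩ʳ x)))           ∎
      where open ≡-Reasoning
    -- The transposition does not move the image of `a`: under `τ`, the vertex `x` is the image of
    -- `x` and `z` is the image of `y`, and `a` is neither.
    ... | no a≢x = begin
      tgt (ε⁺ a)                                        ≡⟨ cong tgt (updateAt-minimal a x ε a≢x) ⟩
      tgt (ε a)                                         ≡⟨ tgt-ε a∈A a≢y ⟩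
      tgt (μ (τ ⟨$⟩ʳ a))                                ≡⟨ cong (tgt ∘ μ) (transpose-mismatch
                                                             (λ eq → a≢x (⟨$⟩ʳ-injective τ (trans eq (sym (τ-fix (inj₂ (here refl)))))))
                                                             (λ eq → a≢y (⟨$⟩ʳ-injective τ (trans eq (sym τ-end))))) ⟨
      tgt (μ (transpose x z ⟨$⟩ʳ (τ ⟨$⟩ʳ a)))           ∎
      where open ≡-Reasoning

  module _ {e} (e∈M : e ∈ M) {f} (sf≢se : src f ≢ src e) where

    -- The path from `succ f` to `src f` is closed by `f` into an `M`-alternating cycle, and `M` is
    -- switched along it. The vertex `src f`, left without an edge by `switch`, receives `f`. An
    -- empty path means that `f` simply replaces the `M`-edge with the same ends.
    exchange : succ f List.∉ [ src e ] → Path [ src e ] (succ f) (src f) →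
      ∃ λ M′ → PerfectMatchingThrough G e M′ × f ∈ M′
    exchange s∉ p = M′ , (pm′ , e∈M′) , f∈M′
      where
      open Switch (switch s∉ p)

      ε⁺ : V → E
      ε⁺ = updateAt ε (src f) (const f)

      ε⁺-f : ε⁺ (src f) ≡ f
      ε⁺-f = updateAt-updates (src f) ε

      src-ε⁺ : ∀ {a} → a ∈ A → src (ε⁺ a) ≡ a
      src-ε⁺ {a} a∈A with a Fin.≟ src f
      ... | yes refl = cong src ε⁺-f
      ... | no  a≢i  = trans (cong src (updateAt-minimal a (src f) ε a≢i)) (src-ε a∈A)

      tgt-ε⁺ : ∀ {a} → a ∈ A → tgt (ε⁺ a) ≡ tgt (μ (τ ⟨$⟩ʳ a))
      tgt-ε⁺ {a} a∈A with a Fin.≟ src f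
      ... | yes refl = begin
        tgt (ε⁺ (src f))               ≡⟨ cong tgt ε⁺-f ⟩
        tgt f                          ≡⟨ tgt-μ (tgt∉A f) ⟨
        tgt (μ (tgt f))                ≡⟨ cong tgt (μ-src (mate∈M G pm (tgt f))) ⟨
        tgt (μ (succ f))               ≡⟨ cong (tgt ∘ μ) τ-end ⟨
        tgt (μ (τ ⟨$⟩ʳ src f))         ∎
        where open ≡-Reasoning
      ... | no a≢i = trans (cong tgt (updateAt-minimal a (src f) ε a≢i)) (tgt-ε a∈A a≢i)

      -- On `A` the map `ε⁺` is a section of `src`, so its image consists of the edges fixed by
      -- `ε⁺ ∘ src`.
      chosen? : Decidable (λ g → ε⁺ (src g) ≡ g)
      chosen? g = ε⁺ (src g) Fin.≟ g

      M′ : Subset #E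
      M′ = comprehension chosen?

      ε⁺∈M′ : ∀ {a} → a ∈ A → ε⁺ a ∈ M′
      ε⁺∈M′ a∈A = ∈-comprehension⁺ chosen? (cong ε⁺ (src-ε⁺ a∈A))

      f∈M′ : f ∈ M′
      f∈M′ = ∈-comprehension⁺ chosen? ε⁺-f

      -- The path avoids `src e`, and `src f` is another vertex, so the edge at `src e` is still the
      -- one from `M`.
      e∈M′ : e ∈ M′
      e∈M′ = ∈-comprehension⁺ chosen? (trans (updateAt-minimal (src e) (src f) ε (sf≢se ∘ sym))
        (trans (ε-fix (here refl)) (μ-src e∈M)))

      pm′ : IsPerfectMatching G M′
      pm′ v with v ∈? A
      ... | yes v∈A = ε⁺ v , (ε⁺∈M′ v∈A , subst (_∈ ends (ε⁺ v)) (src-ε⁺ v∈A) (src∈ends _)) ,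
        λ { (g∈M′ , v∈g) → trans (cong ε⁺ (∈A⇒≡src v∈g v∈A)) (∈-comprehension⁻ chosen? g∈M′) }
      ... | no v∉A = ε⁺ a , (ε⁺∈M′ a∈A , subst (_∈ ends (ε⁺ a)) tgt-ε⁺a (tgt∈ends _)) , unique
        where
        -- The new edge at `v` comes from the vertex that `τ` sends to the old partner of `v`.
        a₀ a : V
        a₀ = src (μ v)
        a  = τ ⟨$⟩ˡ a₀

        -- Since `τ` fixes every vertex outside `A`, it permutes `A`.
        a∈A : a ∈ A
        a∈A with a ∈? A
        ... | yes a∈A = a∈A
        ... | no  a∉A = subst (_∈ A) (trans (sym (inverseʳ τ)) (τ-fix (inj₁ a∉A))) (src∈A (μ v))

        tgt-μ-a₀ : tgt (μ a₀) ≡ v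
        tgt-μ-a₀ = trans (cong tgt (μ-src (mate∈M G pm v))) (tgt-μ v∉A)

        tgt-ε⁺a : tgt (ε⁺ a) ≡ v
        tgt-ε⁺a = trans (tgt-ε⁺ a∈A) (trans (cong (tgt ∘ μ) (inverseʳ τ)) tgt-μ-a₀)

        unique : ∀ {g} → g ∈ M′ × v ∈ ends g → ε⁺ a ≡ g
        unique {g} (g∈M′ , v∈g) = trans (cong ε⁺ a≡) chosen
          where
          chosen : ε⁺ (src g) ≡ g
          chosen = ∈-comprehension⁻ chosen? g∈M′

          eq : tgt (μ (τ ⟨$⟩ʳ src g)) ≡ v
          eq = trans (sym (tgt-ε⁺ (src∈A g))) (trans (cong tgt chosen) (sym (∉A⇒≡tgt v∈g v∉A)))

          τsg∈A : τ ⟨$⟩ʳ src g ∈ A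
          τsg∈A with (τ ⟨$⟩ʳ src g) ∈? A
          ... | yes ∈A = ∈A
          ... | no  ∉A = contradiction
            (subst (_∈ A) (sym (⟨$⟩ʳ-injective τ (τ-fix (inj₁ ∉A)))) (src∈A g)) ∉A

          -- The `M`-partner of `τ (src g)` is `v`, so `τ (src g)` is `a₀`, and `τ` is invertible.
          a≡ : a ≡ src g
          a≡ = trans (cong (τ ⟨$⟩ˡ_) (trans (cong src (trans (cong μ (sym eq)) (μ-tgt (mate∈M G pm _)))) (src-μ τsg∈A)))
            (inverseˡ τ)

    -- If no such matching exists, `exchange` shows that `src f` is not reachable from `succ f` by
    -- paths avoiding `src e`. The reachable vertices are then a set excluded by `noBlockingSet`.
    -- The double negation allows excluded middle to settle reachability at each of the finitely
    -- many vertices.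
    jointlyMatched : NoNontrivialTightCut G → tgt f ≢ tgt e →
      ¬ ¬ (∃ λ M′ → PerfectMatchingThrough G e M′ × f ∈ M′)
    jointlyMatched noCut tf≢te none = Fin.sequence (RawMonad.rawApplicative ¬¬-Monad)
      (λ r → ¬¬-excluded-middle {A = Path [ src e ] (succ f) r}) λ reachable? →
        noBlockingSet noCut pm e∈M reachable? (λ p → end∉Z s∉ p (here refl))
          (succ f , src∈A _ , []) (src f , src∈A f , sf≢se , none ∘ exchange s∉)
          closed
      where
      succ∉ : ∀ g → tgt g ≢ tgt e → succ g List.∉ [ src e ]
      succ∉ g tg≢te (here eq) = tg≢te (trans (sym (tgt-μ (tgt∉A g)))
        (cong tgt (src-injective (mate∈M G pm (tgt g)) e∈M eq)))

      s∉ : succ f List.∉ [ src e ]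
      s∉ = succ∉ f tf≢te

      closed : ∀ g → Path [ src e ] (succ f) (src g) →
        tgt g ≡ tgt e ⊎ Path [ src e ] (succ f) (succ g)
      closed g p with tgt g Fin.≟ tgt e
      ... | yes eq = inj₁ eq
      ... | no  ne = inj₂ (extend p refl (succ∉ g ne))

-- The structure of matching double covered braces.

threeAmongTwo : ∀ {X : Set} {x y a b c : X} → a ≡ x ⊎ a ≡ y → b ≡ x ⊎ b ≡ y → c ≡ x ⊎ c ≡ y →
  a ≡ b ⊎ a ≡ c ⊎ b ≡ c
threeAmongTwo (inj₁ refl) (inj₁ refl) _           = inj₁ refl
threeAmongTwo (inj₁ refl) (inj₂ refl) (inj₁ refl) = inj₂ (inj₁ refl)
threeAmongTwo (inj₁ refl) (inj₂ refl) (inj₂ refl) = inj₂ (inj₂ refl)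
threeAmongTwo (inj₂ refl) (inj₁ refl) (inj₁ refl) = inj₂ (inj₂ refl)
threeAmongTwo (inj₂ refl) (inj₁ refl) (inj₂ refl) = inj₂ (inj₁ refl)
threeAmongTwo (inj₂ refl) (inj₂ refl) _           = inj₁ refl

module DoubleCoveredBrace (G : Graph) (A : Subset (Graph.#V G)) (spanning : ∀ e → e ∈ ∇ G A)
  (mdc : MatchingDoubleCovered G) (noCut : NoNontrivialTightCut G)
  where
  open Graph G
  open Bipartition G A spanning
  open Mates

  record TwoMatchings (e : E) : Set where
    field
      {M₁ M₂} : Subset #E
      M₁≢M₂   : M₁ ≢ M₂
      pm₁     : IsPerfectMatching G M₁
      pm₂     : IsPerfectMatching G M₂
      e∈M₁    : e ∈ M₁
      e∈M₂    : e ∈ M₂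
      only    : ∀ {M} → PerfectMatchingThrough G e M → M ≡ M₁ ⊎ M ≡ M₂

    μ₁ μ₂ : V → E
    μ₁ = μ pm₁
    μ₂ = μ pm₂

    -- Some perfect matching contains both `e` and `f`, and only two contain `e`. Membership is
    -- decidable, which removes the double negation.
    disjoint⇒covered : ∀ {f} → src f ≢ src e → tgt f ≢ tgt e → f ∈ M₁ ⊎ f ∈ M₂
    disjoint⇒covered {f} s≢ t≢ = decidable-stable ((f ∈? M₁) ⊎-dec (f ∈? M₂))
      (¬¬-map (λ { (M , thr , f∈M) →
          ⊎-map (λ eq → subst (f ∈_) eq f∈M) (λ eq → subst (f ∈_) eq f∈M) (only thr) })
        (Exchange.jointlyMatched G A spanning pm₁ e∈M₁ s≢ noCut t≢))

    -- This bounds the degree: a vertex of `A` other than `src e` has at most two edges that miss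
    -- `tgt e`.
    atMostTwo : ∀ {g} → src g ≢ src e → tgt g ≢ tgt e → g ≡ μ₁ (src g) ⊎ g ≡ μ₂ (src g)
    atMostTwo s≢ t≢ = ⊎-map (sym ∘ μ-src pm₁) (sym ∘ μ-src pm₂) (disjoint⇒covered s≢ t≢)

    tgt-μ₁≢ : ∀ {w} → w ∈ A → w ≢ src e → tgt (μ₁ w) ≢ tgt e
    tgt-μ₁≢ w∈A w≢ eq = w≢ (trans (sym (src-μ pm₁ w∈A))
      (cong src (tgt-injective pm₁ (mate∈M G pm₁ _) e∈M₁ eq)))

    tgt-μ₂≢ : ∀ {w} → w ∈ A → w ≢ src e → tgt (μ₂ w) ≢ tgt e
    tgt-μ₂≢ w∈A w≢ eq = w≢ (trans (sym (src-μ pm₂ w∈A))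
      (cong src (tgt-injective pm₂ (mate∈M G pm₂ _) e∈M₂ eq)))

    -- A perfect matching is determined by its edges at the vertices of `A`, because every edge has
    -- an end there.
    differ : ¬ (∀ {a} → a ∈ A → μ₁ a ≡ μ₂ a)
    differ same = M₁≢M₂ (⊆-antisym
      (λ {g} g∈ → subst (_∈ M₂) (trans (sym (same (src∈A g))) (μ-src pm₁ g∈)) (mate∈M G pm₂ _))
      (λ {g} g∈ → subst (_∈ M₁) (trans (same (src∈A g)) (μ-src pm₂ g∈)) (mate∈M G pm₁ _)))

  through : ∀ e → TwoMatchings e
  through e with proj₂ mdc e
  ... | _ , _ , M₁≢M₂ , (pm₁ , e∈M₁) , (pm₂ , e∈M₂) , only = record
    { M₁≢M₂ = M₁≢M₂ ; pm₁ = pm₁ ; pm₂ = pm₂ ; e∈M₁ = e∈M₁ ; e∈M₂ = e∈M₂ ; only = only _ }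

  Joined : V → V → Set
  Joined a b = ∃ λ g → src g ≡ a × tgt g ≡ b

  joined? : ∀ a b → Dec (Joined a b)
  joined? a b = Fin.any? λ g → (src g Fin.≟ a) ×-dec (tgt g Fin.≟ b)

  -- With a single vertex in `A`, both matchings through `e` would reduce to `e` and coincide.
  notOneSource : ∀ {e} → ¬ (∀ {a} → a ∈ A → a ≡ src e)
  notOneSource {e} one = differ λ a∈A → trans (cong μ₁ (one a∈A)) (trans (μ-src pm₁ e∈M₁)
    (sym (trans (cong μ₂ (one a∈A)) (μ-src pm₂ e∈M₂))))
    where open TwoMatchings (through e)

  module TwoSources {M} (pm : IsPerfectMatching G M) {u w} (u∈A : u ∈ A) (w∈A : w ∈ A) (u≢w : u ≢ w)
    (two : ∀ {a} → a ∈ A → a ≡ u ⊎ a ≡ w) where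

    other : ∀ {a} → a ∈ A → ∃ λ a′ → a′ ∈ A × a ≢ a′ × (∀ {x} → x ∈ A → x ≡ a ⊎ x ≡ a′)
    other a∈A with two a∈A
    ... | inj₁ refl = w , w∈A , u≢w , two
    ... | inj₂ refl = u , u∈A , u≢w ∘ sym , ⊎-swap ∘ two

    targets : ∀ {M} (pm : IsPerfectMatching G M) {a a′} → (∀ {x} → x ∈ A → x ≡ a ⊎ x ≡ a′) →
      ∀ {b} → b ∉ A → b ≡ tgt (μ pm a) ⊎ b ≡ tgt (μ pm a′)
    targets pm two {b} b∉A = ⊎-map eq eq (two (src∈A (μ pm b)))
      where
      eq : ∀ {a} → src (μ pm b) ≡ a → b ≡ tgt (μ pm a)
      eq refl = trans (sym (tgt-μ pm b∉A)) (cong tgt (sym (μ-src pm (mate∈M G pm b))))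

    -- If a and b are not joined then {a, b*}, with b* the M-partner of a, is a union of
    -- components.
    complete : ∀ {a b} → a ∈ A → b ∉ A → Joined a b
    complete {a} {b} a∈A b∉A = decidable-stable (joined? a b) incomplete
      where
      incomplete : ¬ ¬ Joined a b
      incomplete none with other a∈A
      ... | a′ , a′∈A , a≢a′ , two′ = [ (λ eq → b∉A (subst (_∈ A) (sym eq) a∈A)) , b*≢b ∘ sym ]′
        -- Membership in `C` is carried backwards along a path from `b` to `a`.
        (fold (λ x y → C y → C x) (λ adj k → closed adj ∘ k) (λ c → c) (proj₁ mdc b a) (inj₁ refl))
        where
        b* : V
        b* = tgt (μ pm a)

        C : V → Set
        C v = v ≡ a ⊎ v ≡ b*

        b*≢b : b* ≢ b
        b*≢b eq = none (μ pm a , src-μ pm a∈A , eq)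

        b≡ : b ≡ tgt (μ pm a′)
        b≡ = [ (λ eq → contradiction (sym eq) b*≢b) , (λ eq → eq) ]′ (targets pm two′ b∉A)

        fromA : ∀ {g} → src g ≡ a → tgt g ≡ b*
        fromA {g} s≡ = [ (λ eq → eq) , (λ eq → contradiction (g , s≡ , trans eq (sym b≡)) none) ]′
          (targets pm two′ (tgt∉A g))

        -- If `g` came from `a′`, a matching through `g` would leave no partner for `a`, whose edges
        -- all end in `b*`.
        toB* : ∀ {g} → tgt g ≡ b* → src g ≡ a
        toB* {g} t≡ with two′ (src∈A g)
        ... | inj₁ s≡a  = s≡a
        ... | inj₂ s≡a′ = contradiction (trans (fromA (src-μ pm₁ a∈A)) (sym t≡))
          (tgt-μ₁≢ a∈A λ eq → a≢a′ (trans eq s≡a′))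
          where open TwoMatchings (through g)

        inside-C : ∀ {y g} → y ∈ ends g → C y → src g ≡ a × tgt g ≡ b*
        inside-C y∈g (inj₁ refl) = let s≡ = sym (∈A⇒≡src y∈g a∈A) in s≡ , fromA s≡
        inside-C y∈g (inj₂ refl) = let t≡ = sym (∉A⇒≡tgt y∈g (tgt∉A (μ pm a))) in toB* t≡ , t≡

        closed : ∀ {x y} → Adjacent G x y → C y → C x
        closed (_ , g , x∈g , y∈g) Cy = let s≡ , t≡ = inside-C y∈g Cy in
          ⊎-map (λ eq → trans eq s≡) (λ eq → trans eq t≡) (ends⁻ x∈g)

    -- Let `e` join the two remaining vertices `a′` and `b′`. A perfect matching through `e`
    -- consists of `e` and one edge from `a` to `b`, so these edges are the ones that the two
    -- matchings through `e` have at `a`.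
    parallelPair : ∀ {a b} → a ∈ A → b ∉ A → ParallelClass 2 a b
    parallelPair {a} {b} a∈A b∉A with other a∈A
    ... | a′ , a′∈A , a≢a′ , two′ with otherTarget
      where
      otherTarget : ∃ λ b′ → b′ ∉ A × b ≢ b′ × (∀ {v} → v ∉ A → v ≢ b′ → v ≡ b)
      otherTarget with targets pm two′ b∉A
      ... | inj₁ refl = tgt (μ pm a′) , tgt∉A _ , a≢a′ ∘ tgt-μ-injective pm a∈A a′∈A
        , λ v∉A ne → [ (λ eq → eq) , (λ eq → contradiction eq ne) ]′ (targets pm two′ v∉A)
      ... | inj₂ refl = tgt (μ pm a) , tgt∉A _ , a≢a′ ∘ sym ∘ tgt-μ-injective pm a′∈A a∈A
        , λ v∉A ne → [ (λ eq → contradiction eq ne) , (λ eq → eq) ]′ (targets pm two′ v∉A)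
    ... | b′ , b′∉A , b≢b′ , only-b with complete a′∈A b′∉A
    ...   | e , refl , refl = record
      { edge      = λ { zero → μ₁ a ; (suc zero) → μ₂ a }
      ; src≡      = λ { zero → src-μ pm₁ a∈A ; (suc zero) → src-μ pm₂ a∈A }
      ; tgt≡      = λ { zero       → only-b (tgt∉A _) (tgt-μ₁≢ a∈A a≢a′)
                      ; (suc zero) → only-b (tgt∉A _) (tgt-μ₂≢ a∈A a≢a′) }
      ; injective = λ { {zero}     {zero}     _  → refl
                      ; {zero}     {suc zero} eq → contradiction eq μ₁≢μ₂
                      ; {suc zero} {zero}     eq → contradiction (sym eq) μ₁≢μ₂
                      ; {suc zero} {suc zero} _  → refl }
      ; complete  = λ { refl refl →
          [ (λ eq → zero , sym eq) , (λ eq → suc zero , sym eq) ]′ (atMostTwo a≢a′ b≢b′) }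
      }
      where
      open TwoMatchings (through e)

      μ₁≢μ₂ : μ₁ a ≢ μ₂ a
      μ₁≢μ₂ eq = differ λ x∈A → [ (λ { refl → eq }) , (λ { refl → trans (μ-src pm₁ e∈M₁) (sym (μ-src pm₂ e∈M₂)) }) ]′ (two′ x∈A)

  module ManySources {M} (pm : IsPerfectMatching G M)
    (third : ∀ x y → ∃ λ z → z ∈ A × z ≢ x × z ≢ y) where

    -- Otherwise all edges at `v` come from `w`, and `v` is the `M`-partner of `w`. For another
    -- vertex `a` and its `M`-edge `e`, the set `A` without `w` and `a` is then blocking: none of
    -- its edges reaches `v`.
    hasOtherSource : ∀ w {v} → v ∉ A → ∃ λ g → tgt g ≡ v × src g ≢ w
    hasOtherSource w {v} v∉A = decidable-stable
      (Fin.any? λ g → (tgt g Fin.≟ v) ×-dec ¬? (src g Fin.≟ w)) λ none →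
        let a , a∈A , a≢w , _ = third w w
            j , j∈A , j≢w , j≢a = third w a
            e = μ pm a
            s≡a = src-μ pm a∈A
            sμv≡w = decidable-stable (src (μ pm v) Fin.≟ w) λ ne → none (μ pm v , tgt-μ pm v∉A , ne)
        in noBlockingSet noCut pm (mate∈M G pm a)
          (λ s → ¬? (s Fin.≟ w) ×-dec ¬? (s Fin.≟ src e))
          (λ (_ , ne) → ne refl)
          (j , j∈A , j≢w , (λ eq → j≢a (trans eq s≡a)))
          (w , subst (_∈ A) sμv≡w (src∈A _) , (λ eq → a≢w (trans (sym s≡a) (sym eq))) , λ (ne , _) → ne refl)
          λ g (s≢w , _) → closed none (mate∈M G pm a) sμv≡w g s≢w
      where
      closed : ¬ (∃ λ g → tgt g ≡ v × src g ≢ w) → ∀ {e} → e ∈ M → src (μ pm v) ≡ w →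
        ∀ g → src g ≢ w → tgt g ≡ tgt e ⊎ (src (μ pm (tgt g)) ≢ w × src (μ pm (tgt g)) ≢ src e)
      closed none {e} e∈M sμv≡w g s≢w with tgt g Fin.≟ tgt e
      ... | yes eq = inj₁ eq
      ... | no  ne = inj₂
        ( (λ eq → none (g , trans (same g (mate∈M G pm v) (trans eq (sym sμv≡w))) (tgt-μ pm v∉A) , s≢w))
        , (λ eq → ne (same g e∈M eq)) )
        where
        same : ∀ g {h} → h ∈ M → src (μ pm (tgt g)) ≡ src h → tgt g ≡ tgt h
        same g h∈M eq = trans (sym (tgt-μ pm (tgt∉A g)))
          (cong tgt (src-injective pm (mate∈M G pm _) h∈M eq))

    -- A vertex `w` with neighbours only in this pair gives the blocking set consisting of `w`
    -- alone, relative to the `M`-edge at `b`. The resulting shore is `w`, its `M`-partner and `b`.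
    leavesPair : ∀ {M} (pm : IsPerfectMatching G M) {w b} → w ∈ A → b ∉ A → b ≢ tgt (μ pm w) →
      ¬ (∀ g → src g ≡ w → tgt g ≡ tgt (μ pm w) ⊎ tgt g ≡ b)
    leavesPair pm {w} {b} w∈A b∉A b≢ confined =
      let i , i∈A , i≢w , i≢s = third w (src (μ pm b))
      in noBlockingSet noCut pm (mate∈M G pm b) {S = _≡ w} (Fin._≟ w)
        (λ eq → b≢ (trans (sym (tgt-μ pm b∉A))
          (cong tgt (trans (sym (μ-src pm (mate∈M G pm b))) (cong (μ pm) eq)))))
        (w , w∈A , refl) (i , i∈A , i≢s , i≢w)
        λ g s≡w → [ (λ eq → inj₂ (trans (cong (src ∘ μ pm) eq)
                      (trans (cong src (μ-tgt pm (mate∈M G pm w))) (src-μ pm w∈A))))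
                  , (λ eq → inj₁ (trans eq (sym (tgt-μ pm b∉A)))) ]′ (confined g s≡w)

    complete : ∀ {w v} → w ∈ A → v ∉ A → Joined w v
    complete {w} {v} w∈A v∉A = decidable-stable (joined? w v) incomplete
      where
      incomplete : ¬ ¬ Joined w v
      incomplete none with hasOtherSource w v∉A
      -- Every edge at `w` misses `v` and is thus disjoint from `e`, so `atMostTwo` leaves `w` at
      -- most two neighbours.
      ... | e , refl , s≢w = impossible
        where
        open TwoMatchings (through e)

        atW : ∀ g → src g ≡ w → tgt g ≡ tgt (μ₁ w) ⊎ tgt g ≡ tgt (μ₂ w)
        atW g refl = ⊎-map (cong tgt) (cong tgt)
          (atMostTwo (s≢w ∘ sym) λ eq → none (g , refl , eq))

        impossible : ⊥
        impossible with tgt (μ₂ w) Fin.≟ tgt (μ₁ w)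
        -- Here `w` has one neighbour only, and its non-neighbour `v` fills the second place of the
        -- pair.
        ... | yes eq = leavesPair pm₁ w∈A v∉A (tgt-μ₁≢ w∈A (s≢w ∘ sym) ∘ sym)
          λ g s≡w → inj₁ ([ (λ eq → eq) , (λ eq′ → trans eq′ eq) ]′ (atW g s≡w))
        ... | no ne = leavesPair pm₁ w∈A (tgt∉A (μ₂ w)) ne atW

    -- An edge `e` at `v` from a different source is disjoint from all three, so they lie among two
    -- edges.
    threeAvoiding : ∀ {v g h k} → v ∉ A → src h ≡ src g → src k ≡ src g →
      tgt g ≢ v → tgt h ≢ v → tgt k ≢ v → g ≡ h ⊎ g ≡ k ⊎ h ≡ k
    threeAvoiding {g = g} {h} {k} v∉A sh sk g≢ h≢ k≢ with hasOtherSource (src g) v∉A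
    ... | e , refl , s≢ = threeAmongTwo (at refl g≢) (at sh h≢) (at sk k≢)
      where
      open TwoMatchings (through e)

      at : ∀ {f} → src f ≡ src g → tgt f ≢ tgt e → f ≡ μ₁ (src g) ⊎ f ≡ μ₂ (src g)
      at s≡ t≢ = subst (λ a → _ ≡ μ₁ a ⊎ _ ≡ μ₂ a) s≡ (atMostTwo (λ eq → s≢ (trans (sym eq) s≡)) t≢)

    -- The supply of further vertices passes from `A` to the other class through `M`.
    thirdTarget : ∀ {x y} → x ∉ A → y ∉ A → ∃ λ z → z ∉ A × z ≢ x × z ≢ y
    thirdTarget {x} {y} x∉A y∉A with third (src (μ pm x)) (src (μ pm y))
    ... | a , a∈A , a≢x , a≢y = tgt (μ pm a) , tgt∉A _ , ne a≢x , ne a≢y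
      where
      ne : ∀ {x} → a ≢ src (μ pm x) → tgt (μ pm a) ≢ x
      ne a≢ refl = a≢ (trans (sym (src-μ pm a∈A)) (cong src (sym (μ-tgt pm (mate∈M G pm a)))))

    -- An edge `k` from the same source to a further vertex `b` joins the parallel edges `g` and `h`
    -- in `threeAvoiding`, with `v` yet another vertex. As `k` ends elsewhere, the coincidence must
    -- be between `g` and `h`.
    simple : ∀ {g h} → src g ≡ src h → tgt g ≡ tgt h → g ≡ h
    simple {g} {h} s≡ t≡ with thirdTarget (tgt∉A g) (tgt∉A g)
    ... | v , v∉A , v≢ , _ with thirdTarget (tgt∉A g) v∉A
    ...   | b , b∉A , b≢t , b≢v with complete (src∈A g) b∉A
    ...     | k , sk , refl with threeAvoiding {g = g} {h} {k} v∉A (sym s≡) sk (v≢ ∘ sym) (λ eq → v≢ (trans (sym eq) (sym t≡))) b≢v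
    ...       | inj₁ eq          = eq
    ...       | inj₂ (inj₁ refl) = contradiction refl b≢t
    ...       | inj₂ (inj₂ refl) = contradiction (sym t≡) b≢t

    parallelClass : ∀ {a b} → a ∈ A → b ∉ A → ParallelClass 1 a b
    parallelClass a∈A b∉A with complete a∈A b∉A
    ... | e , refl , refl = record
      { edge      = λ _ → e
      ; src≡      = λ _ → refl
      ; tgt≡      = λ _ → refl
      ; injective = λ { {zero} {zero} _ → refl }
      ; complete  = λ s≡ t≡ → zero , simple (sym s≡) (sym t≡)
      }

    -- If `v` were a fourth target, the edges from `a` to `b₁`, `b₂` and `b₃` would be three
    -- distinct edges avoiding `v`.
    onlyThreeTargets : ∀ {a} → a ∈ A → ∀ {b₁ b₂ b₃ v} → b₁ ∉ A → b₂ ∉ A → b₃ ∉ A → v ∉ A →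
      b₁ ≢ b₂ → b₁ ≢ b₃ → b₂ ≢ b₃ → v ≡ b₁ ⊎ v ≡ b₂ ⊎ v ≡ b₃
    onlyThreeTargets a∈A {b₁} {b₂} {b₃} {v} b₁∉ b₂∉ b₃∉ v∉ b₁≢b₂ b₁≢b₃ b₂≢b₃ =
      decidable-stable ((v Fin.≟ b₁) ⊎-dec ((v Fin.≟ b₂) ⊎-dec (v Fin.≟ b₃))) fourth
      where
      fourth : ¬ ¬ (v ≡ b₁ ⊎ v ≡ b₂ ⊎ v ≡ b₃)
      fourth ne with complete a∈A b₁∉ | complete a∈A b₂∉ | complete a∈A b₃∉
      ... | g , refl , refl | h , sh , refl | k , sk , refl
        with threeAvoiding {g = g} {h} {k} v∉ sh sk
               (ne ∘ inj₁ ∘ sym) (ne ∘ inj₂ ∘ inj₁ ∘ sym) (ne ∘ inj₂ ∘ inj₂ ∘ sym)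
      ... | inj₁ refl        = b₁≢b₂ refl
      ... | inj₂ (inj₁ refl) = b₁≢b₃ refl
      ... | inj₂ (inj₂ refl) = b₂≢b₃ refl

-- Complete bipartite graphs of constant multiplicity.

injective∧surjective⇒↔ : ∀ {A B : Set} (f : A → B) → (∀ {x y} → f x ≡ f y → x ≡ y) →
  (∀ y → ∃ λ x → f x ≡ y) → A ↔ B
injective∧surjective⇒↔ f injective surjective =
  mk↔ₛ′ f (proj₁ ∘ surjective) (proj₂ ∘ surjective) (λ x → injective (proj₂ (surjective (f x))))

-- G is K_{k,k} with every edge replaced by m parallel edges.
record UniformBiclique (k m : ℕ) (G : Graph) : Set where
  open Graph G
  field
    vertices : Fin #V ↔ (Fin k ⊎ Fin k)
    edges    : Fin #E ↔ (Fin k × Fin k × Fin m)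

  vertex : Fin #V → Fin k ⊎ Fin k
  vertex = Inverse.to vertices

  row : Fin #E → Fin k
  row = proj₁ ∘ Inverse.to edges

  col : Fin #E → Fin k
  col = proj₁ ∘ proj₂ ∘ Inverse.to edges

  field
    incidence : ∀ v e → v ∈ ends e ⇔ (vertex v ≡ inj₁ (row e) ⊎ vertex v ≡ inj₂ (col e))

-- Incidence depends on the coordinates alone, so identifying equal coordinates is an isomorphism.
uniformBiclique-unique : ∀ {k m G H} → UniformBiclique k m G → UniformBiclique k m H → G ≅ H
uniformBiclique-unique {G = G} bG bH = record
  { onV = ↔-trans bG.vertices (↔-sym bH.vertices)
  ; onE = ↔-trans bG.edges (↔-sym bH.edges)
  ; preserves-incidence = λ v e → ⇔-sym (bH.incidence _ _) ⇔-∘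
      subst₂ (λ x d → v ∈ Graph.ends G e ⇔ (x ≡ inj₁ (proj₁ d) ⊎ x ≡ inj₂ (proj₁ (proj₂ d))))
        (sym (Inverse.strictlyInverseˡ bH.vertices _)) (sym (Inverse.strictlyInverseˡ bH.edges _))
        (bG.incidence v e)
  }
  where
  module bG = UniformBiclique bG
  module bH = UniformBiclique bH

module Incidence {k m} (G : Graph)
  (vertex : Fin (Graph.#V G) → Fin k ⊎ Fin k)
  (edge : Fin (Graph.#E G) → Fin k × Fin k × Fin m) where
  open Graph G

  Incident : Fin #V → Fin #E → Set
  Incident v e = vertex v ≡ inj₁ (proj₁ (edge e)) ⊎ vertex v ≡ inj₂ (proj₁ (proj₂ (edge e)))

  incident? : ∀ v e → Dec (Incident v e)
  incident? v e = (vertex v ≟⊎ _) ⊎-dec (vertex v ≟⊎ _)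
    where _≟⊎_ = ⊎.≡-dec Fin._≟_ Fin._≟_

  incidence? : Dec (∀ v e → (v ∈ ends e → Incident v e) × (Incident v e → v ∈ ends e))
  incidence? = all? λ v → all? λ e →
    (v ∈? ends e →-dec incident? v e) ×-dec (incident? v e →-dec v ∈? ends e)

K₃₃-biclique : UniformBiclique 3 1 K₃₃
K₃₃-biclique = record
  { vertices  = Fin.+↔⊎
  ; edges     = mk↔ₛ′ edge (λ (i , j , _) → combine i j)
      (λ { (i , j , zero) → cong (λ (i , j) → i , j , zero) (Fin.remQuot-combine i j) })
      (Fin.combine-remQuot {3} 3)
  ; incidence = λ v e →
      let to , from = from-yes (Incidence.incidence? K₃₃ (splitAt 3) edge) v e in mk⇔ to from
  }
  where
  edge : Fin 9 → Fin 3 × Fin 3 × Fin 1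
  edge e = let i , j = remQuot {3} 3 e in i , j , zero

C₄⁴-biclique : UniformBiclique 2 2 C₄⁴
C₄⁴-biclique = record
  { vertices  = mk↔ₛ′ vertex vertex⁻¹
      (λ { (inj₁ zero) → refl ; (inj₁ (suc zero)) → refl ; (inj₂ zero) → refl ; (inj₂ (suc zero)) → refl })
      (λ { zero → refl ; (suc zero) → refl ; (suc (suc zero)) → refl ; (suc (suc (suc zero))) → refl })
  ; edges     = mk↔ₛ′ edge edge⁻¹
      (λ (i , j , l) → from-yes (all? λ i → all? λ j → all? λ l →
        ×-≡-dec (edge (edge⁻¹ (i , j , l))) (i , j , l)) i j l)
      (from-yes (all? λ e → edge⁻¹ (edge e) Fin.≟ e))
  ; incidence = λ v e →
      let to , from = from-yes (Incidence.incidence? C₄⁴ vertex edge) v e in mk⇔ to from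
  }
  where
  ×-≡-dec = ×.≡-dec Fin._≟_ (×.≡-dec Fin._≟_ Fin._≟_)

  -- The even vertices of the cycle form one class and the odd vertices the other.
  vertex : Fin 4 → Fin 2 ⊎ Fin 2
  vertex zero                   = inj₁ zero
  vertex (suc zero)             = inj₂ zero
  vertex (suc (suc zero))       = inj₁ (suc zero)
  vertex (suc (suc (suc zero))) = inj₂ (suc zero)

  vertex⁻¹ : Fin 2 ⊎ Fin 2 → Fin 4
  vertex⁻¹ (inj₁ zero)       = zero
  vertex⁻¹ (inj₂ zero)       = suc zero
  vertex⁻¹ (inj₁ (suc zero)) = suc (suc zero)
  vertex⁻¹ (inj₂ (suc zero)) = suc (suc (suc zero))

  -- Side `c` joins `c` and `next c`; its even end gives the row and its odd end the column.
  cell : Fin 4 → Fin 2 × Fin 2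
  cell zero                   = zero , zero
  cell (suc zero)             = suc zero , zero
  cell (suc (suc zero))       = suc zero , suc zero
  cell (suc (suc (suc zero))) = zero , suc zero

  cell⁻¹ : Fin 2 → Fin 2 → Fin 4
  cell⁻¹ zero       zero       = zero
  cell⁻¹ (suc zero) zero       = suc zero
  cell⁻¹ (suc zero) (suc zero) = suc (suc zero)
  cell⁻¹ zero       (suc zero) = suc (suc (suc zero))

  edge : Fin 8 → Fin 2 × Fin 2 × Fin 2
  edge e = let c , l = remQuot {4} 2 e ; i , j = cell c in i , j , l

  edge⁻¹ : Fin 2 × Fin 2 × Fin 2 → Fin 8
  edge⁻¹ (i , j , l) = combine (cell⁻¹ i j) l

module _ (G : Graph) (A : Subset (Graph.#V G)) (spanning : ∀ e → e ∈ ∇ G A)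
  {M} (pm : IsPerfectMatching G M) where
  open Graph G
  open Bipartition G A spanning
  open Mates pm

  -- Column `j` is the `M`-partner of row `j`, so an enumeration of `A` also enumerates the other
  -- class.
  uniformBiclique : ∀ {k m} (source : Fin k → V) → (∀ i → source i ∈ A) →
    (∀ {i j} → source i ≡ source j → i ≡ j) → (∀ {v} → v ∈ A → ∃ λ i → source i ≡ v) →
    (∀ {a b} → a ∈ A → b ∉ A → ParallelClass m a b) →
    UniformBiclique k m G
  uniformBiclique {k} {m} source source∈A source-injective source-surjective parallel = record
    { vertices  = ↔-sym (injective∧surjective⇒↔ place place-injective place-surjective)
    ; edges     = ↔-sym (injective∧surjective⇒↔ edge edge-injective edge-surjective)
    ; incidence = λ v e → mk⇔ (to v e) (from v e)
    }
    where
    target : Fin k → V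
    target = tgt ∘ μ ∘ source

    target∉A : ∀ j → target j ∉ A
    target∉A j = tgt∉A _

    target-injective : ∀ {i j} → target i ≡ target j → i ≡ j
    target-injective = source-injective ∘ tgt-μ-injective (source∈A _) (source∈A _)

    target-surjective : ∀ {v} → v ∉ A → ∃ λ j → target j ≡ v
    target-surjective {v} v∉A with source-surjective (src∈A (μ v))
    ... | j , eq = j , trans (cong (tgt ∘ μ) eq)
      (trans (cong tgt (μ-src (mate∈M G pm v))) (tgt-μ v∉A))

    place : Fin k ⊎ Fin k → V
    place = [ source , target ]′

    place-injective : ∀ {x y} → place x ≡ place y → x ≡ y
    place-injective {inj₁ i} {inj₁ j} eq = cong inj₁ (source-injective eq)
    place-injective {inj₂ i} {inj₂ j} eq = cong inj₂ (target-injective eq)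
    place-injective {inj₁ i} {inj₂ j} eq = contradiction (subst (_∈ A) eq (source∈A i)) (target∉A j)
    place-injective {inj₂ i} {inj₁ j} eq = contradiction (subst (_∈ A) (sym eq) (source∈A j)) (target∉A i)

    place-surjective : ∀ v → ∃ λ x → place x ≡ v
    place-surjective v with v ∈? A
    ... | yes v∈A = let i , eq = source-surjective v∈A in inj₁ i , eq
    ... | no  v∉A = let j , eq = target-surjective v∉A in inj₂ j , eq

    module Class i j = ParallelClass (parallel (source∈A i) (target∉A j))

    edge : Fin k × Fin k × Fin m → E
    edge (i , j , l) = Class.edge i j l

    src-edge : ∀ x → src (edge x) ≡ source (proj₁ x)
    src-edge (i , j , l) = Class.src≡ i j l

    tgt-edge : ∀ x → tgt (edge x) ≡ target (proj₁ (proj₂ x))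
    tgt-edge (i , j , l) = Class.tgt≡ i j l

    edge-injective : ∀ {x y} → edge x ≡ edge y → x ≡ y
    edge-injective {x@(i , j , _)} {y} eq
      with source-injective (trans (sym (src-edge x)) (trans (cong src eq) (src-edge y)))
         | target-injective (trans (sym (tgt-edge x)) (trans (cong tgt eq) (tgt-edge y)))
    ... | refl | refl = cong (λ l → i , j , l) (Class.injective i j eq)

    edge-surjective : ∀ g → ∃ λ x → edge x ≡ g
    edge-surjective g with source-surjective (src∈A g) | target-surjective (tgt∉A g)
    ... | i , si | j , tj with Class.complete i j (sym si) (sym tj)
    ...   | l , eq = (i , j , l) , eq

    vertex : V → Fin k ⊎ Fin k
    vertex = proj₁ ∘ place-surjective

    place-vertex : ∀ v → place (vertex v) ≡ v
    place-vertex = proj₂ ∘ place-surjective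

    cell : E → Fin k × Fin k × Fin m
    cell = proj₁ ∘ edge-surjective

    edge-cell : ∀ g → edge (cell g) ≡ g
    edge-cell = proj₂ ∘ edge-surjective

    src≡ : ∀ e → src e ≡ place (inj₁ (proj₁ (cell e)))
    src≡ e = trans (cong src (sym (edge-cell e))) (src-edge (cell e))

    tgt≡ : ∀ e → tgt e ≡ place (inj₂ (proj₁ (proj₂ (cell e))))
    tgt≡ e = trans (cong tgt (sym (edge-cell e))) (tgt-edge (cell e))

    to : ∀ v e → v ∈ ends e → vertex v ≡ inj₁ (proj₁ (cell e)) ⊎ vertex v ≡ inj₂ (proj₁ (proj₂ (cell e)))
    to v e v∈e = ⊎-map
      (λ eq → place-injective (trans (place-vertex v) (trans eq (src≡ e))))
      (λ eq → place-injective (trans (place-vertex v) (trans eq (tgt≡ e)))) (ends⁻ v∈e)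

    from : ∀ v e → vertex v ≡ inj₁ (proj₁ (cell e)) ⊎ vertex v ≡ inj₂ (proj₁ (proj₂ (cell e))) → v ∈ ends e
    from v e (inj₁ eq) = subst (_∈ ends e) (trans (src≡ e) (trans (cong place (sym eq)) (place-vertex v))) (src∈ends e)
    from v e (inj₂ eq) = subst (_∈ ends e) (trans (tgt≡ e) (trans (cong place (sym eq)) (place-vertex v))) (tgt∈ends e)

-- Invariance under isomorphism.

module _ {n m} (π : Fin n ↔ Fin m) where
  open Inverse π

  module _ (S : Subset m) where

    private
      in? : Decidable (λ x → to x ∈ S)
      in? x = to x ∈? S

    preimage : Subset n
    preimage = comprehension in?

    ∈-preimage⁺ : ∀ {x} → to x ∈ S → x ∈ preimage
    ∈-preimage⁺ = ∈-comprehension⁺ in?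

    ∈-preimage⁻ : ∀ {x} → x ∈ preimage → to x ∈ S
    ∈-preimage⁻ = ∈-comprehension⁻ in?

    ∣preimage∣ : ∣ preimage ∣ ≡ ∣ S ∣
    ∣preimage∣ = bijection⇒∣p∣≡∣q∣ preimage S to from
      (λ x∈ → ∈-preimage⁻ x∈ , strictlyInverseʳ _)
      (λ y∈S → ∈-preimage⁺ (subst (_∈ S) (sym (strictlyInverseˡ _)) y∈S) , strictlyInverseˡ _)

preimage-sym : ∀ {n m} (π : Fin n ↔ Fin m) S → preimage π (preimage (↔-sym π) S) ≡ S
preimage-sym π S = ⊆-antisym
  (λ x∈ → subst (_∈ S) (strictlyInverseʳ _) (∈-preimage⁻ (↔-sym π) S (∈-preimage⁻ π _ x∈)))
  (λ x∈ → ∈-preimage⁺ π _ (∈-preimage⁺ (↔-sym π) S (subst (_∈ S) (sym (strictlyInverseʳ _)) x∈)))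
  where open Inverse π

≅-sym : ∀ {G H} → G ≅ H → H ≅ G
≅-sym {G} {H} iso = record
  { onV = ↔-sym onV
  ; onE = ↔-sym onE
  ; preserves-incidence = λ v e → ⇔-sym (subst₂ (λ x d → V.from v ∈ Graph.ends G (E.from e) ⇔ x ∈ Graph.ends H d)
      (V.strictlyInverseˡ v) (E.strictlyInverseˡ e) (preserves-incidence (V.from v) (E.from e)))
  }
  where
  open _≅_ iso
  module V = Inverse onV
  module E = Inverse onE

perfectMatching-preimage : ∀ {G H} (iso : G ≅ H) {M} → IsPerfectMatching H M →
  IsPerfectMatching G (preimage (_≅_.onE iso) M)
perfectMatching-preimage {G} {H} iso {M} pm v =
  E.from f
  , (∈-preimage⁺ onE M (subst (_∈ M) (sym (E.strictlyInverseˡ f)) (mate∈M H pm (V.to v)))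
    , Equivalence.from (preserves-incidence v (E.from f))
        (subst (λ d → V.to v ∈ Graph.ends H d) (sym (E.strictlyInverseˡ f)) (∈-ends-mate H pm (V.to v))))
  , λ { {e} (e∈ , v∈e) → trans
      (cong E.from (mate-unique H pm (∈-preimage⁻ onE M e∈) (Equivalence.to (preserves-incidence v e) v∈e)))
      (E.strictlyInverseʳ e) }
  where
  open _≅_ iso
  module V = Inverse onV
  module E = Inverse onE
  f : Fin (Graph.#E H)
  f = mate H pm (V.to v)

module Transport {G H : Graph} (iso : G ≅ H) where
  open _≅_ iso
  open Graph
  private
    module V = Inverse onV
    module E = Inverse onE

  adjacent : ∀ {x y} → Adjacent H x y → Adjacent G (V.from x) (V.from y)
  adjacent (x≢y , e , x∈e , y∈e) =
    (λ eq → x≢y (trans (sym (V.strictlyInverseˡ _)) (trans (cong V.to eq) (V.strictlyInverseˡ _))))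
    , E.from e
    , Equivalence.to (_≅_.preserves-incidence (≅-sym iso) _ e) x∈e
    , Equivalence.to (_≅_.preserves-incidence (≅-sym iso) _ e) y∈e

  connected : Connected H → Connected G
  connected conn u v = subst₂ (Star (Adjacent G)) (V.strictlyInverseʳ u) (V.strictlyInverseʳ v)
    (gmap V.from adjacent (conn (V.to u) (V.to v)))

  matchingDoubleCovered : MatchingDoubleCovered H → MatchingDoubleCovered G
  matchingDoubleCovered (conn , double) = connected conn , λ e →
    let M₁ , M₂ , M₁≢M₂ , (pm₁ , e∈M₁) , (pm₂ , e∈M₂) , only = double (E.to e)
    in preimage onE M₁ , preimage onE M₂
     , (λ eq → M₁≢M₂ (trans (sym (preimage-sym (↔-sym onE) M₁))
         (trans (cong (preimage (↔-sym onE)) eq) (preimage-sym (↔-sym onE) M₂))))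
     , (perfectMatching-preimage iso pm₁ , ∈-preimage⁺ onE M₁ e∈M₁)
     , (perfectMatching-preimage iso pm₂ , ∈-preimage⁺ onE M₂ e∈M₂)
     , λ { M (pm , e∈M) → ⊎-map (reflect M) (reflect M)
         (only (preimage (↔-sym onE) M)
           ( perfectMatching-preimage (≅-sym iso) pm
           , ∈-preimage⁺ (↔-sym onE) M (subst (_∈ M) (sym (E.strictlyInverseʳ e)) e∈M))) }
    where
    reflect : ∀ M {M′} → preimage (↔-sym onE) M ≡ M′ → M ≡ preimage onE M′
    reflect M eq = trans (sym (preimage-sym onE M)) (cong (preimage onE) eq)

  noNontrivialTightCut : NoNontrivialTightCut H → NoNontrivialTightCut G
  noNontrivialTightCut noCut (X , (odd , tight) , nontrivial) = noCut
    ( X′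
    , (trans (cong (_% 2) ∣X′∣) odd , λ M pm → trans (∣∇X′∩M∣ M) (tight _ (perfectMatching-preimage iso pm)))
    , nontrivial ∘ ⊎-map (trans (sym ∣X′∣)) (trans (sym ∣∁X′∣)) )
    where
    -- The image of `X` under `onV`, formed as a preimage under the inverse. Cut sizes agree because
    -- a perfect matching of `H` is compared with its pullback to `G`.
    X′ : Subset (#V H)
    X′ = preimage (↔-sym onV) X

    ∣X′∣ : ∣ X′ ∣ ≡ ∣ X ∣
    ∣X′∣ = ∣preimage∣ (↔-sym onV) X

    ∈X′ : ∀ {v} → v ∈ X → V.to v ∈ X′
    ∈X′ v∈X = ∈-preimage⁺ (↔-sym onV) X (subst (_∈ X) (sym (V.strictlyInverseʳ _)) v∈X)

    ∈X′⁻ : ∀ {v} → V.to v ∈ X′ → v ∈ X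
    ∈X′⁻ ∈X′ = subst (_∈ X) (V.strictlyInverseʳ _) (∈-preimage⁻ (↔-sym onV) X ∈X′)

    ∣∁X′∣ : ∣ ∁ X′ ∣ ≡ ∣ ∁ X ∣
    ∣∁X′∣ = bijection⇒∣p∣≡∣q∣ (∁ X′) (∁ X) V.from V.to
      (λ x∈ → x∉p⇒x∈∁p (λ ∈X → x∈∁p⇒x∉p x∈ (∈-preimage⁺ (↔-sym onV) X ∈X)) , V.strictlyInverseˡ _)
      (λ v∈ → x∉p⇒x∈∁p (x∈∁p⇒x∉p v∈ ∘ ∈X′⁻) , V.strictlyInverseʳ _)

    ∣ends∩∣ : ∀ e → ∣ ends G e ∩ X ∣ ≡ ∣ ends H (E.to e) ∩ X′ ∣
    ∣ends∩∣ e = bijection⇒∣p∣≡∣q∣ (ends G e ∩ X) (ends H (E.to e) ∩ X′) V.to V.from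
      (λ {v} v∈ → let v∈e , v∈X = x∈p∩q⁻ (ends G e) X v∈ in
        x∈p∩q⁺ (Equivalence.to (preserves-incidence v e) v∈e , ∈X′ v∈X) , V.strictlyInverseʳ v)
      (λ {x} x∈ → let x∈e , x∈X′ = x∈p∩q⁻ (ends H (E.to e)) X′ x∈ in
        x∈p∩q⁺
          ( subst (λ d → V.from x ∈ ends G d) (E.strictlyInverseʳ e)
              (Equivalence.to (_≅_.preserves-incidence (≅-sym iso) x (E.to e)) x∈e)
          , ∈-preimage⁻ (↔-sym onV) X x∈X′ )
        , V.strictlyInverseˡ x)

    ∣∇X′∩M∣ : ∀ M → ∣ ∇ H X′ ∩ M ∣ ≡ ∣ ∇ G X ∩ preimage onE M ∣
    ∣∇X′∩M∣ M = trans (sym (∣preimage∣ onE _)) (cong ∣_∣ (⊆-antisym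
      (λ {e} e∈ → let e∈∇ , e∈M = x∈p∩q⁻ (∇ H X′) M (∈-preimage⁻ onE _ e∈) in
        x∈p∩q⁺ (∈∇⁺ G (trans (∣ends∩∣ e) (∈∇⁻ H e∈∇)) , ∈-preimage⁺ onE M e∈M))
      (λ {e} e∈ → let e∈∇ , e∈M = x∈p∩q⁻ (∇ G X) (preimage onE M) e∈ in
        ∈-preimage⁺ onE _ (x∈p∩q⁺ (∈∇⁺ H (trans (sym (∣ends∩∣ e)) (∈∇⁻ G e∈∇)) , ∈-preimage⁻ onE M e∈M)))))

-- Verification of the two small graphs by exhaustive search.

module Check (H : Graph) (M₁ M₂ : Fin (Graph.#E H) → Subset (Graph.#E H)) where
  open Graph H

  adjacent? : ∀ u v → Dec (Adjacent H u v)
  adjacent? u v = ¬? (u Fin.≟ v) ×-dec any? λ e → (u ∈? ends e) ×-dec (v ∈? ends e)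

  perfectMatching? : Decidable (IsPerfectMatching H)
  perfectMatching? M = all? λ v → map′
    (λ (e , e-ok , unique) → e , e-ok , λ {f} → unique f)
    (λ (e , e-ok , unique) → e , e-ok , λ f → unique {f})
    (any? λ e → ((e ∈? M) ×-dec (v ∈? ends e))
      ×-dec all? λ f → ((f ∈? M) ×-dec (v ∈? ends f)) →-dec (e Fin.≟ f))

  -- Membership of `e` is tested first, which rejects many subsets before the matching condition is
  -- examined.
  through? : ∀ e M → Dec (PerfectMatchingThrough H e M)
  through? e M = map′ ×-swap ×-swap ((e ∈? M) ×-dec perfectMatching? M)

  _≟ˢ_ : (M M′ : Subset #E) → Dec (M ≡ M′)
  _≟ˢ_ = Vec-≡-dec Bool._≟_

  -- Diameter at most two, which both target graphs satisfy, replaces a search for longer paths.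
  Reachable₂ : Set
  Reachable₂ = ∀ u v → u ≡ v ⊎ Adjacent H u v ⊎ ∃ λ w → Adjacent H u w × Adjacent H w v

  reachable₂? : Dec Reachable₂
  reachable₂? = all? λ u → all? λ v → (u Fin.≟ v) ⊎-dec adjacent? u v ⊎-dec
    any? λ w → adjacent? u w ×-dec adjacent? w v

  connected : Reachable₂ → Connected H
  connected reach u v with reach u v
  ... | inj₁ refl                 = Star.ε
  ... | inj₂ (inj₁ uv)            = uv ◅ Star.ε
  ... | inj₂ (inj₂ (_ , uw , wv)) = uw ◅ wv ◅ Star.ε

  TwoThrough : Set
  TwoThrough = ∀ e → M₁ e ≢ M₂ e × PerfectMatchingThrough H e (M₁ e) × PerfectMatchingThrough H e (M₂ e)

  twoThrough? : Dec TwoThrough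
  twoThrough? = all? λ e → ¬? (M₁ e ≟ˢ M₂ e) ×-dec through? e (M₁ e) ×-dec through? e (M₂ e)

  Third : Set
  Third = ∃ λ M → ∃ λ e → PerfectMatchingThrough H e M × M ≢ M₁ e × M ≢ M₂ e

  third? : Dec Third
  third? = anySubset? λ M → any? λ e → through? e M ×-dec ¬? (M ≟ˢ M₁ e) ×-dec ¬? (M ≟ˢ M₂ e)

  -- Tightness is tested only on the matchings `M₁ e`. This condition is weaker than tightness, so
  -- excluding it excludes every nontrivial tight cut.
  OddCut : Set
  OddCut = ∃ λ X → (∣ X ∣ % 2 ≡ 1 × ∀ e → ∣ ∇ H X ∩ M₁ e ∣ ≡ 1) × ¬ TrivialCut H X

  oddCut? : Dec OddCut
  oddCut? = anySubset? λ X → ((∣ X ∣ % 2 ≟ 1) ×-dec all? λ e → ∣ ∇ H X ∩ M₁ e ∣ ≟ 1)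
    ×-dec ¬? ((∣ X ∣ ≟ 1) ⊎-dec (∣ ∁ X ∣ ≟ 1))

  matchingDoubleCovered : Reachable₂ → TwoThrough → ¬ Third → MatchingDoubleCovered H
  matchingDoubleCovered reach two noThird = connected reach , λ e →
    let M₁≢M₂ , thr₁ , thr₂ = two e
    in M₁ e , M₂ e , M₁≢M₂ , thr₁ , thr₂ , λ M thr →
      decidable-stable ((M ≟ˢ M₁ e) ⊎-dec (M ≟ˢ M₂ e)) λ ne →
        noThird (M , e , thr , ne ∘ inj₁ , ne ∘ inj₂)

  noNontrivialTightCut : TwoThrough → ¬ OddCut → NoNontrivialTightCut H
  noNontrivialTightCut two noCut (X , (odd , tight) , nontrivial) =
    noCut (X , (odd , λ e → tight (M₁ e) (proj₁ (proj₁ (proj₂ (two e))))) , nontrivial)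

-- The two perfect matchings of K₃₃ through ij: all xy with y − x = j − i, and all xy with
-- x + y = i + j, modulo 3.
K₃₃-difference K₃₃-sum : Fin 9 → Subset 9
K₃₃-difference e = let i , j = remQuot {3} 3 e in comprehension λ f →
  let x , y = remQuot {3} 3 f in (toℕ y + toℕ i) % 3 ≟ (toℕ j + toℕ x) % 3
K₃₃-sum e = let i , j = remQuot {3} 3 e in comprehension λ f →
  let x , y = remQuot {3} 3 f in (toℕ x + toℕ y) % 3 ≟ (toℕ i + toℕ j) % 3

-- A perfect matching of `C₄⁴` through `e` consists of `e` and one of the two edges on the opposite
-- side of the cycle; `l` selects that edge.
C₄⁴-withOpposite : Fin 2 → Fin 8 → Subset 8
C₄⁴-withOpposite l e =
  let c , _ = remQuot {4} 2 e in ⁅ e ⁆ ∪ ⁅ combine {4} {2} (next (next c)) l ⁆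

module CheckK₃₃ = Check K₃₃ K₃₃-difference K₃₃-sum
module CheckC₄⁴ = Check C₄⁴ (C₄⁴-withOpposite zero) (C₄⁴-withOpposite (suc zero))

K₃₃-twoThrough : CheckK₃₃.TwoThrough
K₃₃-twoThrough = from-yes CheckK₃₃.twoThrough?

C₄⁴-twoThrough : CheckC₄⁴.TwoThrough
C₄⁴-twoThrough = from-yes CheckC₄⁴.twoThrough?

K₃₃-matchingDoubleCovered : MatchingDoubleCovered K₃₃
K₃₃-matchingDoubleCovered = CheckK₃₃.matchingDoubleCovered
  (from-yes CheckK₃₃.reachable₂?) K₃₃-twoThrough (from-no CheckK₃₃.third?)

C₄⁴-matchingDoubleCovered : MatchingDoubleCovered C₄⁴
C₄⁴-matchingDoubleCovered = CheckC₄⁴.matchingDoubleCovered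
  (from-yes CheckC₄⁴.reachable₂?) C₄⁴-twoThrough (from-no CheckC₄⁴.third?)

K₃₃-noNontrivialTightCut : NoNontrivialTightCut K₃₃
K₃₃-noNontrivialTightCut = CheckK₃₃.noNontrivialTightCut K₃₃-twoThrough (from-no CheckK₃₃.oddCut?)

C₄⁴-noNontrivialTightCut : NoNontrivialTightCut C₄⁴
C₄⁴-noNontrivialTightCut = CheckC₄⁴.noNontrivialTightCut C₄⁴-twoThrough (from-no CheckC₄⁴.oddCut?)

-- Classification by the size of a colour class.

classification : ∀ {G} → HasPerfectMatching G → 0 < Graph.#E G → Bipartite G →
  MatchingDoubleCovered G → NoNontrivialTightCut G → G ≅ K₃₃ ⊎ G ≅ C₄⁴
classification {G} (_ , pm) (s≤s _) (A , spanning) mdc noCut = cases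
  where
  open Graph G
  open Bipartition G A spanning
  open Mates pm
  open DoubleCoveredBrace G A spanning mdc noCut

  -- The graph has an edge, so `zero` names one and provides a first vertex of `A`.
  u : V
  u = src zero

  module _ {w} (w∈A : w ∈ A) (w≢u : w ≢ u) where

    two : (∀ {a} → a ∈ A → a ≡ u ⊎ a ≡ w) → G ≅ C₄⁴
    two only = uniformBiclique-unique
      (uniformBiclique G A spanning pm source source∈A source-injective source-surjective
        parallelPair)
      C₄⁴-biclique
      where
      open TwoSources pm (src∈A zero) w∈A (w≢u ∘ sym) only

      source : Fin 2 → V
      source zero       = u
      source (suc zero) = w

      source∈A : ∀ i → source i ∈ A
      source∈A zero       = src∈A zero
      source∈A (suc zero) = w∈A

      source-injective : ∀ {i j} → source i ≡ source j → i ≡ j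
      source-injective {zero}     {zero}     _  = refl
      source-injective {zero}     {suc zero} eq = contradiction (sym eq) w≢u
      source-injective {suc zero} {zero}     eq = contradiction eq w≢u
      source-injective {suc zero} {suc zero} _  = refl

      source-surjective : ∀ {v} → v ∈ A → ∃ λ i → source i ≡ v
      source-surjective v∈A = [ (λ eq → zero , sym eq) , (λ eq → suc zero , sym eq) ]′ (only v∈A)

    three : ∀ {x} → x ∈ A → x ≢ u → x ≢ w → G ≅ K₃₃
    three {x} x∈A x≢u x≢w = uniformBiclique-unique
      (uniformBiclique G A spanning pm source source∈A source-injective source-surjective
        parallelClass)
      K₃₃-biclique
      where
      -- Two vertices cannot account for the three distinct vertices `u`, `w` and `x`.
      third : ∀ y z → ∃ λ v → v ∈ A × v ≢ y × v ≢ z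
      third y z = decidable-stable
        (any? λ v → (v ∈? A) ×-dec (¬? (v Fin.≟ y) ×-dec ¬? (v Fin.≟ z))) λ none →
          let oneOf : ∀ {v} → v ∈ A → v ≡ y ⊎ v ≡ z
              oneOf {v} v∈A = decidable-stable ((v Fin.≟ y) ⊎-dec (v Fin.≟ z))
                λ ne → none (v , v∈A , ne ∘ inj₁ , ne ∘ inj₂)
          in [ w≢u ∘ sym , [ x≢u ∘ sym , x≢w ∘ sym ]′ ]′
               (threeAmongTwo (oneOf (src∈A zero)) (oneOf w∈A) (oneOf x∈A))

      open ManySources pm third

      source : Fin 3 → V
      source zero             = u
      source (suc zero)       = w
      source (suc (suc zero)) = x

      source∈A : ∀ i → source i ∈ A
      source∈A zero             = src∈A zero
      source∈A (suc zero)       = w∈A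
      source∈A (suc (suc zero)) = x∈A

      source-injective : ∀ {i j} → source i ≡ source j → i ≡ j
      source-injective {zero}           {zero}           _  = refl
      source-injective {zero}           {suc zero}       eq = contradiction (sym eq) w≢u
      source-injective {zero}           {suc (suc zero)} eq = contradiction (sym eq) x≢u
      source-injective {suc zero}       {zero}           eq = contradiction eq w≢u
      source-injective {suc zero}       {suc zero}       _  = refl
      source-injective {suc zero}       {suc (suc zero)} eq = contradiction (sym eq) x≢w
      source-injective {suc (suc zero)} {zero}           eq = contradiction eq x≢u
      source-injective {suc (suc zero)} {suc zero}       eq = contradiction eq x≢w
      source-injective {suc (suc zero)} {suc (suc zero)} _  = refl

      -- The bound of three on the targets is carried back to `A` by the injectivity of
      -- `M`-partners.
      source-surjective : ∀ {v} → v ∈ A → ∃ λ i → source i ≡ v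
      source-surjective v∈A =
        [ partner zero , [ partner (suc zero) , partner (suc (suc zero)) ]′ ]′
          (onlyThreeTargets (src∈A zero) (tgt∉A _) (tgt∉A _) (tgt∉A _) (tgt∉A _)
            (w≢u ∘ sym ∘ tgt-μ-injective (src∈A zero) w∈A)
            (x≢u ∘ sym ∘ tgt-μ-injective (src∈A zero) x∈A)
            (x≢w ∘ sym ∘ tgt-μ-injective w∈A x∈A))
        where
        partner : ∀ i → tgt (μ _) ≡ tgt (μ (source i)) → ∃ λ i → source i ≡ _
        partner i eq = i , sym (tgt-μ-injective v∈A (source∈A i) eq)

  cases : G ≅ K₃₃ ⊎ G ≅ C₄⁴
  -- The class `A` has one vertex, exactly two, or at least three; the first case is impossible.
  cases with any? (λ w → (w ∈? A) ×-dec ¬? (w Fin.≟ u))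
  ... | no none = ⊥-elim (notOneSource λ {a} a∈A →
    decidable-stable (a Fin.≟ u) λ ne → none (a , a∈A , ne))
  ... | yes (w , w∈A , w≢u)
    with any? (λ x → (x ∈? A) ×-dec (¬? (x Fin.≟ u) ×-dec ¬? (x Fin.≟ w)))
  ...   | no none = inj₂ (two w∈A w≢u λ {a} a∈A →
    decidable-stable ((a Fin.≟ u) ⊎-dec (a Fin.≟ w)) λ ne → none (a , a∈A , ne ∘ inj₁ , ne ∘ inj₂))
  ...   | yes (x , x∈A , x≢u , x≢w) = inj₁ (three w∈A w≢u x∈A x≢u x≢w)

matchingDoubleCovered⇒matchingCovered : ∀ G → MatchingDoubleCovered G → MatchingCovered G
matchingDoubleCovered⇒matchingCovered _ (conn , double) =
  conn , λ e → let M₁ , _ , _ , thr₁ , _ = double e in M₁ , thr₁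

corollary1p8 : (G : Graph) → HasPerfectMatching G → 0 < Graph.#E G → Bipartite G →
    (MatchingDoubleCovered G × Brace G) ⇔ (G ≅ K₃₃ ⊎ G ≅ C₄⁴)
corollary1p8 G hasPM nonempty bipartite = mk⇔
  (λ { (mdc , _ , _ , noCut) → classification hasPM nonempty bipartite mdc noCut })
  [ (λ iso → doubleCoveredBrace iso K₃₃-matchingDoubleCovered K₃₃-noNontrivialTightCut)
  , (λ iso → doubleCoveredBrace iso C₄⁴-matchingDoubleCovered C₄⁴-noNontrivialTightCut) ]′
  where
  doubleCoveredBrace : ∀ {H} → G ≅ H → MatchingDoubleCovered H →
    NoNontrivialTightCut H → MatchingDoubleCovered G × Brace G
  doubleCoveredBrace iso mdc noCut =
    let mdcG = Transport.matchingDoubleCovered iso mdc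
    in mdcG , bipartite , matchingDoubleCovered⇒matchingCovered G mdcG
     , Transport.noNontrivialTightCut iso noCut
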